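{- $$F_{1\text{ - }23}(x,y)=1+xF_{1\text{ - }23}(x,y)+\sum_{d\ge 1}x^{d+1}y^{\binom d2}F_{1\text{ - }23}(x,y)\prod_{j=0}^{d-1}F_{1\text{ - }23}(xy^j,y).$$
   Context: An occurrence of the generalized pattern $1\text{ - }23$ in $\pi=\pi_1\cdots\pi_n\in S_n$ is a pair of positions $a<b$ with $b+1\le n$ and $\pi_a<\pi_b<\pi_{b+1}$ (the letters playing the roles of 2 and 3 must be adjacent). A permutation is $1\text{ - }3\text{ - }2$-avoiding if there are no positions $a<b<c$ with $\pi_a<\pi_c<\pi_b$. $f_{\tau;r}(n)$ is the number of $1\text{ - }3\text{ - }2$-avoiding permutations in $S_n$ containing exactly $r$ occurrences of $\tau$ (with $S_0$ consisting of the empty permutation), and $F_\tau(x,y)=\sum_{n,r\ge 0} f_{\tau;r}(n)x^ny^r$, a formal power series in $x$ with coefficients in $\mathbb Z[y]$. The convention $\binom12=0$ is used. -}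

module Defs where

open import Algebra.Bundles.Raw using (RawSemiring)
import Algebra.Definitions.RawSemiring as SemiringOps
open import Data.Fin.Base as Fin using (Fin; toℕ)
import Data.Fin.Properties as Fin
open import Data.Integer.Base as ℤ using (ℤ; 0ℤ)
import Data.Integer.Properties as ℤ
open import Data.List.Base as List
  using (List; []; _∷_; length; filter; allFin; cartesianProduct; cartesianProductWith)
import Data.List.Properties as List
import Data.List.Relation.Unary.All as All
open import Data.Nat.Base as ℕ using (ℕ; zero; suc; _∸_; _≤_; _<_; s≤s)
open import Data.Nat.Combinatorics using (_C_)
import Data.Nat.Properties as ℕ
open import Data.Product.Base using (_×_; _,_; ∃-syntax)
open import Data.Sum.Base using (inj₁; inj₂)
open import Data.Vec.Base as Vec using (Vec; lookup)
import Data.Vec.Relation.Unary.AllPairs as AllPairs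
open import Data.Vec.Relation.Unary.Unique.Propositional using (Unique)
open import Level using (Level)
open import Relation.Binary.PropositionalEquality
open import Relation.Nullary using (Dec; ¬_; ¬?; _×-dec_)

-- Permutations in one-line notation.  Letters and positions are elements of
-- Fin n, i.e. both are numbered from 0.

-- Every word of length k over Fin n, listed exactly once.
words : ∀ k n → List (Vec (Fin n) k)
words zero    n = Vec.[] ∷ []
words (suc k) n = cartesianProductWith Vec._∷_ (allFin n) (words k n)

unique? : ∀ {k n} (w : Vec (Fin n) k) → Dec (Unique w)
unique? = AllPairs.allPairs? (λ x y → ¬? (x Fin.≟ y))

S : ∀ n → List (Vec (Fin n) n)
S n = filter unique? (words n n)

Occurs132 : ∀ {n} → Vec (Fin n) n → Set
Occurs132 π = ∃[ a ] ∃[ b ] ∃[ c ]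
  a Fin.< b × b Fin.< c × lookup π a Fin.< lookup π c × lookup π c Fin.< lookup π b

occurs132? : ∀ {n} (π : Vec (Fin n) n) → Dec (Occurs132 π)
occurs132? π = Fin.any? λ a → Fin.any? λ b → Fin.any? λ c →
  a Fin.<? b ×-dec b Fin.<? c ×-dec
  lookup π a Fin.<? lookup π c ×-dec lookup π c Fin.<? lookup π b

Avoids132 : ∀ {n} → Vec (Fin n) n → Set
Avoids132 π = ¬ Occurs132 π

-- The position b⁺ is b + 1; its existence says that b is not the last position.
Occurrence1-23 : ∀ {n} → Vec (Fin n) n → Fin n × Fin n → Set
Occurrence1-23 π (a , b) = a Fin.< b ×
  ∃[ b⁺ ] toℕ b⁺ ≡ suc (toℕ b) ×
          lookup π a Fin.< lookup π b × lookup π b Fin.< lookup π b⁺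

occurrence1-23? : ∀ {n} (π : Vec (Fin n) n) ab → Dec (Occurrence1-23 π ab)
occurrence1-23? π (a , b) = a Fin.<? b ×-dec Fin.any? λ b⁺ →
  toℕ b⁺ ℕ.≟ suc (toℕ b) ×-dec
  lookup π a Fin.<? lookup π b ×-dec lookup π b Fin.<? lookup π b⁺

positionPairs : ∀ n → List (Fin n × Fin n)
positionPairs n = cartesianProduct (allFin n) (allFin n)

occurrences1-23 : ∀ {n} → Vec (Fin n) n → ℕ
occurrences1-23 {n} π = length (filter (occurrence1-23? π) (positionPairs n))

f1-23 : (r n : ℕ) → ℕ
f1-23 r n = length (filter (λ π → ¬? (occurs132? π) ×-dec occurrences1-23 π ℕ.≟ r) (S n))

-- Formal power series over a semiring R, as coefficient sequences.

module PowerSeries {c ℓ : Level} (R : RawSemiring c ℓ) where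
  private
    module R = RawSemiring R
  open SemiringOps R using (sum; _^_)

  Series : Set c
  Series = ℕ → R.Carrier

  _⊛_ : Series → Series → Series
  (s ⊛ t) n = sum {n = suc n} λ i → s (toℕ i) R.* t (n ∸ toℕ i)

  constant : R.Carrier → Series
  constant p zero    = p
  constant p (suc n) = R.0#

  X : Series
  X 1 = R.1#
  X _ = R.0#

  rawSemiring : RawSemiring c ℓ
  rawSemiring = record
    { Carrier = Series
    ; _≈_     = λ s t → ∀ n → s n R.≈ t n
    ; _+_     = λ s t n → s n R.+ t n
    ; _*_     = _⊛_
    ; 0#      = λ _ → R.0#
    ; 1#      = constant R.1#
    }

  -- s[ p ·X] is s(p x).
  _[_·X] : Series → R.Carrier → Series
  (s [ p ·X]) n = (p ^ n) R.* s n

  LocallyFinite : (ℕ → Series) → Set ℓ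
  LocallyFinite g = ∀ k n → n < k → g k n R.≈ R.0#

  -- The sum of all g k, k ≥ 0: by local finiteness only g 0, …, g n
  -- contribute to the coefficient of xⁿ.
  ∑∞ : (g : ℕ → Series) → LocallyFinite g → Series
  ∑∞ g _ n = sum {n = suc n} λ k → g (toℕ k) n

-- ℤ[y], as the power series over ℤ with finitely many non-zero coefficients.

module ℤ⟦y⟧ where
  open PowerSeries ℤ.+-*-rawSemiring public
  open RawSemiring rawSemiring public
  open SemiringOps ℤ.+-*-rawSemiring public using (sum)

record ℤ[y] : Set where
  field
    coeff    : ℕ → ℤ
    bound    : ℕ
    vanishes : ∀ r → bound ≤ r → coeff r ≡ 0ℤ

open ℤ[y] public

private
  sum-zero : ∀ {n} (t : Fin n → ℤ) → (∀ i → t i ≡ 0ℤ) → ℤ⟦y⟧.sum t ≡ 0ℤ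
  sum-zero {zero}  t t≡0 = refl
  sum-zero {suc n} t t≡0 =
    cong₂ ℤ._+_ (t≡0 Fin.zero) (sum-zero (λ i → t (Fin.suc i)) (λ i → t≡0 (Fin.suc i)))

  zeroˡ : ∀ {u} v → u ≡ 0ℤ → u ℤ.* v ≡ 0ℤ
  zeroˡ v refl = ℤ.*-zeroˡ v

  zeroʳ : ∀ u {v} → v ≡ 0ℤ → u ℤ.* v ≡ 0ℤ
  zeroʳ u refl = ℤ.*-zeroʳ u

  +-vanishes : ∀ p q r → bound p ℕ.+ bound q ≤ r → coeff p r ℤ.+ coeff q r ≡ 0ℤ
  +-vanishes p q r b≤r = cong₂ ℤ._+_
    (vanishes p r (ℕ.m+n≤o⇒m≤o (bound p) b≤r))
    (vanishes q r (ℕ.m+n≤o⇒n≤o (bound p) b≤r))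

  *-vanishes : ∀ p q r → bound p ℕ.+ bound q ≤ r → (coeff p ℤ⟦y⟧.* coeff q) r ≡ 0ℤ
  *-vanishes p q r b≤r = sum-zero {suc r} _ λ i → go (toℕ i)
    where
    go : ∀ i → coeff p i ℤ.* coeff q (r ∸ i) ≡ 0ℤ
    go i with ℕ.≤-total (bound p) i
    ... | inj₁ bp≤i = zeroˡ _ (vanishes p i bp≤i)
    ... | inj₂ i≤bp = zeroʳ (coeff p i) (vanishes q (r ∸ i)
      (ℕ.m+n≤o⇒m≤o∸n (bound q) (ℕ.≤-trans
        (ℕ.≤-reflexive (ℕ.+-comm (bound q) i))
        (ℕ.≤-trans (ℕ.+-monoˡ-≤ (bound q) i≤bp) b≤r))))

  constant-vanishes : ∀ k r → 1 ≤ r → ℤ⟦y⟧.constant k r ≡ 0ℤ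
  constant-vanishes k (suc r) _ = refl

  X-vanishes : ∀ r → 2 ≤ r → ℤ⟦y⟧.X r ≡ 0ℤ
  X-vanishes (suc (suc r)) _ = refl
  X-vanishes (suc zero)    (s≤s ())

ℤ[y]-rawSemiring : RawSemiring _ _
ℤ[y]-rawSemiring = record
  { Carrier = ℤ[y]
  ; _≈_     = λ p q → coeff p ℤ⟦y⟧.≈ coeff q
  ; _+_     = λ p q → record
      { coeff    = coeff p ℤ⟦y⟧.+ coeff q
      ; bound    = bound p ℕ.+ bound q
      ; vanishes = +-vanishes p q }
  ; _*_     = λ p q → record
      { coeff    = coeff p ℤ⟦y⟧.* coeff q
      ; bound    = bound p ℕ.+ bound q
      ; vanishes = *-vanishes p q }
  ; 0#      = record { coeff = ℤ⟦y⟧.0# ; bound = 0 ; vanishes = λ _ _ → refl }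
  ; 1#      = record { coeff = ℤ⟦y⟧.1# ; bound = 1 ; vanishes = constant-vanishes _ }
  }

open SemiringOps ℤ[y]-rawSemiring public using () renaming (_^_ to _^ʸ_)

y : ℤ[y]
y = record { coeff = ℤ⟦y⟧.X ; bound = 2 ; vanishes = X-vanishes }

-- From here on, Series is ℤ[y][[x]] and X is the variable x.

open PowerSeries ℤ[y]-rawSemiring public
open RawSemiring rawSemiring public using (_≈_; _+_; _*_; 0#; 1#)
open SemiringOps rawSemiring public using (_^_; product)

private
  filter-empty : ∀ {A : Set} {P : A → Set} (P? : ∀ x → Dec (P x)) xs →
                 (∀ x → ¬ P x) → length (filter P? xs) ≡ 0
  filter-empty P? xs ¬P = cong length (List.filter-none P? (All.universal ¬P xs))

  length-allFin : ∀ n → length (allFin n) ≡ n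
  length-allFin n = List.length-tabulate {n = n} (λ i → i)

  length-pairs : ∀ {A B : Set} (xs : List A) (ys : List B) →
                 length (cartesianProduct xs ys) ≡ length xs ℕ.* length ys
  length-pairs []       ys = refl
  length-pairs (x ∷ xs) ys = trans (List.length-++ (List.map (x ,_) ys))
    (cong₂ ℕ._+_ (List.length-map (x ,_) ys) (length-pairs xs ys))

  occurrences-bound : ∀ {n} (π : Vec (Fin n) n) → occurrences1-23 π ≤ n ℕ.* n
  occurrences-bound {n} π = ℕ.≤-trans
    (List.length-filter (occurrence1-23? π) (positionPairs n))
    (ℕ.≤-reflexive (trans (length-pairs (allFin n) (allFin n))
                          (cong₂ ℕ._*_ (length-allFin n) (length-allFin n))))

  f1-23-vanishes : ∀ n r → suc (n ℕ.* n) ≤ r → ℤ.+ f1-23 r n ≡ 0ℤ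
  f1-23-vanishes n r n²<r = cong ℤ.+_ (filter-empty _ (S n)
    λ { π (_ , refl) → ℕ.<⇒≱ n²<r (occurrences-bound π) })

F1-23 : Series
F1-23 n = record
  { coeff    = λ r → ℤ.+ f1-23 r n
  ; bound    = suc (n ℕ.* n)
  ; vanishes = f1-23-vanishes n
  }

-- The product includes the factor j = 0, which is F1-23 itself;
-- 1 C 2 = 0.
summand : ℕ → Series
summand d = X ^ suc d * constant (y ^ʸ (d C 2)) * F1-23
       * product {n = d} (λ j → F1-23 [ y ^ʸ toℕ j ·X])

private
  open RawSemiring ℤ[y]-rawSemiring using () renaming (_≈_ to _≈ʸ_; 0# to 0ʸ; _*_ to _*ʸ_)
  open SemiringOps ℤ[y]-rawSemiring using (sum)

  Order≥ : ℕ → Series → Set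
  Order≥ k s = ∀ n → n < k → s n ≈ʸ 0ʸ

  *ʸ-zeroˡ : ∀ p q → p ≈ʸ 0ʸ → (p *ʸ q) ≈ʸ 0ʸ
  *ʸ-zeroˡ p q p≈0 r = sum-zero {suc r}
    (λ i → coeff p (toℕ i) ℤ.* coeff q (r ∸ toℕ i))
    (λ i → zeroˡ (coeff q (r ∸ toℕ i)) (p≈0 (toℕ i)))

  *ʸ-zeroʳ : ∀ p q → q ≈ʸ 0ʸ → (p *ʸ q) ≈ʸ 0ʸ
  *ʸ-zeroʳ p q q≈0 r = sum-zero {suc r}
    (λ i → coeff p (toℕ i) ℤ.* coeff q (r ∸ toℕ i))
    (λ i → zeroʳ (coeff p (toℕ i)) (q≈0 (r ∸ toℕ i)))

  sumʸ-zero : ∀ {n} (t : Fin n → ℤ[y]) → (∀ i → t i ≈ʸ 0ʸ) → sum t ≈ʸ 0ʸ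
  sumʸ-zero {zero}  t t≈0 r = refl
  sumʸ-zero {suc n} t t≈0 r =
    cong₂ ℤ._+_ (t≈0 Fin.zero r) (sumʸ-zero (λ i → t (Fin.suc i)) (λ i → t≈0 (Fin.suc i)) r)

  order-* : ∀ k s t → Order≥ k s → Order≥ k (s * t)
  order-* k s t s≥k n n<k = sumʸ-zero {suc n}
    (λ i → s (toℕ i) *ʸ t (n ∸ toℕ i))
    (λ i → *ʸ-zeroˡ (s (toℕ i)) (t (n ∸ toℕ i)) (s≥k (toℕ i) (ℕ.<-≤-trans (Fin.toℕ<n i) n<k)))

  order-X* : ∀ k s → Order≥ k s → Order≥ (suc k) (X * s)
  order-X* k s s≥k n (s≤s n≤k) = sumʸ-zero {suc n}
    (λ i → X (toℕ i) *ʸ s (n ∸ toℕ i))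
    (λ i → go (toℕ i) (ℕ.≤-pred (Fin.toℕ<n i)))
    where
    go : ∀ i → i ≤ n → (X i *ʸ s (n ∸ i)) ≈ʸ 0ʸ
    go zero          _   = *ʸ-zeroˡ (X 0) (s n) (λ _ → refl)
    go (suc zero)    1≤n = *ʸ-zeroʳ (X 1) (s (n ∸ 1)) (s≥k (n ∸ 1)
      (ℕ.<-≤-trans (ℕ.∸-monoʳ-< {n} {1} {0} (ℕ.n<1+n 0) 1≤n) n≤k))
    go (suc (suc i)) _   = *ʸ-zeroˡ (X (suc (suc i))) (s (n ∸ suc (suc i))) (λ _ → refl)

  order-X^ : ∀ k → Order≥ k (X ^ k)
  order-X^ zero    n ()
  order-X^ (suc k) = order-X* k (X ^ k) (order-X^ k)

  order-summand : ∀ d → Order≥ (suc d) (summand d)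
  order-summand d =
    order-* (suc d) (xᵈ⁺¹ * yᵏ * F1-23) ∏ (order-* (suc d) (xᵈ⁺¹ * yᵏ) F1-23
      (order-* (suc d) xᵈ⁺¹ yᵏ (order-X^ (suc d))))
    where
    xᵈ⁺¹ = X ^ suc d
    yᵏ   = constant (y ^ʸ (d C 2))
    ∏    = product {n = d} (λ j → F1-23 [ y ^ʸ toℕ j ·X])

-- Summing over k ≥ 0 with d = suc k is summing over d ≥ 1.
summand-locallyFinite : LocallyFinite (λ k → summand (suc k))
summand-locallyFinite k n n<k = order-summand (suc k) n (ℕ.m<n⇒m<1+n (ℕ.m<n⇒m<1+n n<k))

module Submission where

-- Let G(x, y) count the 1-3-2-avoiding permutations α by the occurrences of 1-23 in α ⊕ 1.
-- A non-empty 1-3-2-avoiding permutation is β ⊖ (α ⊕ 1), split at its last letter, with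
-- unique 1-3-2-avoiding α and β; here ⊕ 1 appends a new largest letter, and the letters
-- of β exceed all the others.  Its occurrences of 1-23 are those in β and those in α ⊕ 1,
-- and one more new largest letter at the end creates |α| further occurrences, so that
--   F(x) = 1 + x F(x) G(x)   and   G(x) = 1 + x F(x) G(xy).
-- Iterating the second equation inside the first gives the formula.

open import Algebra.Bundles using (CommutativeSemiring; Monoid)
open import Algebra.Bundles.Raw using (RawSemiring)
import Algebra.Definitions.RawSemiring as SemiringOps
import Algebra.Properties.CommutativeSemigroup as CommutativeSemigroupProperties
import Algebra.Properties.CommutativeSemiring.Exp as Exp
import Algebra.Properties.Monoid.Sum as MonoidSum
import Algebra.Properties.Semiring.Sum as Sum
import Algebra.Solver.CommutativeMonoid as CommutativeMonoidSolver
open import Algebra.Structures using (IsCommutativeSemiring)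
open import Algebra.Structures.Biased using (isCommutativeSemiringˡ)
open import Data.Bool.Base using (Bool; true; false; _∧_)
open import Data.Bool.Properties using (∧-zeroʳ)
open import Data.Fin.Base as Fin using (Fin; zero; suc; toℕ; fromℕ<)
import Data.Fin.Properties as Fin
import Data.Integer.Base as ℤ
import Data.Integer.Properties as ℤ
open import Data.List.Base
  using (List; []; _∷_; _++_; _∷ʳ_; length; map; filter; concat; tabulate; allFin;
        cartesianProduct; cartesianProductWith; initLast; _∷ʳ′_)
open import Data.List.Membership.Propositional using (_∈_)
open import Data.List.Membership.Propositional.Properties
open import Data.List.Membership.Propositional.Properties.WithK using (unique∧set⇒bag)
open import Data.List.Properties
  using (∷-injectiveˡ; ∷-injectiveʳ; ∷ʳ-injective; ++-assoc; ++-identityʳ; length-++;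
        length-map; map-injective; map-tabulate; map-∘; map-cong; filter-++)
open import Data.List.Relation.Binary.BagAndSetEquality using (∼bag⇒↭)
open import Data.List.Relation.Binary.Permutation.Propositional as ↭ using (_↭_)
open import Data.List.Relation.Unary.All as All using (All; []; _∷_)
import Data.List.Relation.Unary.All.Properties as All
open import Data.List.Relation.Unary.AllPairs as AllPairs using (AllPairs; []; _∷_)
import Data.List.Relation.Unary.AllPairs.Properties as AllPairs
import Data.List.Relation.Unary.Any.Properties as Any
open import Data.List.Relation.Unary.Unique.Propositional using (Unique)
import Data.List.Relation.Unary.Unique.Propositional.Properties as Unique
open import Data.Nat.Base as ℕ
  using (ℕ; zero; suc; _∸_; _<_; _≤_; _<ᵇ_; s≤s; s<s; z<s; s<s⁻¹; s≤s⁻¹)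
open import Data.Nat.Combinatorics using (_C_; nCk+nC[k+1]≡[n+1]C[k+1]; nC1≡n)
import Data.Nat.ListAction as ListAction
import Data.Nat.Properties as ℕ
open import Data.Product.Base using (_×_; _,_; proj₁; proj₂; ∃-syntax)
open import Data.Unit.Base using (⊤; tt)
open import Data.Vec.Base as Vec using (Vec; []; _∷_; lookup)
import Data.Vec.Properties as Vec
import Data.Vec.Relation.Unary.All as VecAll
import Data.Vec.Relation.Unary.AllPairs as VecAllPairs
import Data.Vec.Relation.Unary.Unique.Propositional as Vec
import Data.Vec.Relation.Unary.Unique.Propositional.Properties as VecUnique
open import Function.Base using (_∘_; id)
open import Function.Bundles using (_⇔_; mk⇔; Equivalence)
open import Level using (Level)
open import Relation.Binary.Structures using (IsEquivalence)
open import Relation.Binary.PropositionalEquality as ≡ using (_≡_; _≢_)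
import Relation.Binary.Reasoning.Setoid as ≈-Reasoning
open import Relation.Nullary using (yes; no; does; ¬_; ¬?; _×-dec_)
open import Relation.Nullary.Decidable using (does-⇔; dec-true; dec-false)
open import Relation.Unary using (Decidable)
import Defs

-- Power series

-- F alone is not closed under the decomposition. A new largest letter at the end adds as many
-- occurrences as there are letters below the previous last letter, and neither the size nor the
-- number of occurrences determines that number. Splitting once more turns it into a length, and
-- weighting by y to the length is the substitution of xy for x. At depth d the equation for G is
-- used at xy^d, where its factor x brings in y^d. The exponents 0, ..., d - 1 collected on the way
-- add up to `d C 2`, and the series F(xy^j) collected alongside form the product. No limit is
-- taken: after N steps the identity is exact with a remainder divisible by x^(N+1), so each
-- coefficient is settled by finitely many steps. On the combinatorial side the decomposition is a
-- reordering of duplicate-free lists, which lets polynomial weights be summed over it directly.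

module PowerSeriesProperties {c ℓ : Level} (R : CommutativeSemiring c ℓ) where
  private
    module R = CommutativeSemiring R
    module S = Sum R.semiring
    open Defs.PowerSeries R.rawSemiring
    open SemiringOps rawSemiring using (_^_) renaming (sum to sumˢ)
    open SemiringOps R.rawSemiring using () renaming (_^_ to _^ᴿ_)
    open RawSemiring rawSemiring using (_≈_; _+_; _*_; 0#; 1#)
    open Exp R using (^-congˡ; ^-distrib-*)

  infixr 8 _·_
  _·_ : R.Carrier → Series → Series
  (p · s) n = p R.* s n

  tail : Series → Series
  tail s = s ∘ suc

  private
    open ≈-Reasoning R.setoid

    terms : Series → Series → ∀ n → Fin (suc n) → R.Carrier
    terms s t n i = s (toℕ i) R.* t (n ∸ toℕ i)

    sum-cong : ∀ n {f g : Fin n → R.Carrier} → (∀ i → f i R.≈ g i) → S.sum f R.≈ S.sum g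
    sum-cong n f≈g = S.sum-cong-≋ f≈g

  *-cong : ∀ {s s′ t t′} → s ≈ s′ → t ≈ t′ → (s * t) ≈ (s′ * t′)
  *-cong {s} {s′} {t} {t′} s≈s′ t≈t′ n = sum-cong (suc n) {terms s t n} {terms s′ t′ n}
    λ i → R.*-cong (s≈s′ (toℕ i)) (t≈t′ (n ∸ toℕ i))

  *-zeroˡ : ∀ s → (0# * s) ≈ 0#
  *-zeroˡ s n = R.trans
    (sum-cong (suc n) {terms 0# s n} λ i → R.zeroˡ (s (n ∸ toℕ i)))
    (S.sum-replicate-zero (suc n))

  *-distribʳ : ∀ s t u → ((t + u) * s) ≈ ((t * s) + (u * s))
  *-distribʳ s t u n = R.trans
    (sum-cong (suc n) {terms (t + u) s n} λ i → R.distribʳ (s (n ∸ toℕ i)) (t (toℕ i)) (u (toℕ i)))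
    (S.∑-distrib-+ (terms t s n) (terms u s n))

  ·-*-assoc : ∀ p s t → ((p · s) * t) ≈ (p · (s * t))
  ·-*-assoc p s t n = R.trans
    (sum-cong (suc n) {terms (p · s) t n} λ i → R.*-assoc p (s (toℕ i)) (t (n ∸ toℕ i)))
    (R.sym (S.*-distribˡ-sum p (terms s t n)))

  -- Unfolding the defining sum from its first term, (s * t)ₙ₊₁ = s₀ tₙ₊₁ + (tail s * t)ₙ
  -- holds definitionally; this is the same identity from the last term.
  *-suc : ∀ s t n → (s * t) (suc n) R.≈ s (suc n) R.* t 0 R.+ (s * tail t) n
  *-suc s t zero    = begin
    s 0 R.* t 1 R.+ (s 1 R.* t 0 R.+ R.0#)  ≈⟨ R.+-congˡ (R.+-identityʳ _) ⟩
    s 0 R.* t 1 R.+ s 1 R.* t 0             ≈⟨ R.+-comm _ _ ⟩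
    s 1 R.* t 0 R.+ s 0 R.* t 1             ≈⟨ R.+-congˡ (R.+-identityʳ _) ⟨
    s 1 R.* t 0 R.+ (s 0 R.* t 1 R.+ R.0#)  ∎
  *-suc s t (suc n) = begin
    s 0 R.* t (2 ℕ.+ n) R.+ (tail s * t) (suc n)
      ≈⟨ R.+-congˡ (*-suc (tail s) t n) ⟩
    s 0 R.* t (2 ℕ.+ n) R.+ (s (2 ℕ.+ n) R.* t 0 R.+ (tail s * tail t) n)
      ≈⟨ R.+-assoc _ _ _ ⟨
    s 0 R.* t (2 ℕ.+ n) R.+ s (2 ℕ.+ n) R.* t 0 R.+ (tail s * tail t) n
      ≈⟨ R.+-congʳ (R.+-comm _ _) ⟩
    s (2 ℕ.+ n) R.* t 0 R.+ s 0 R.* t (2 ℕ.+ n) R.+ (tail s * tail t) n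
      ≈⟨ R.+-assoc _ _ _ ⟩
    s (2 ℕ.+ n) R.* t 0 R.+ (s * tail t) (suc n) ∎

  -- Exchanging the factors turns the recursion from the first term into the recursion from the last
  -- term.
  *-comm : ∀ s t → (s * t) ≈ (t * s)
  *-comm s t zero    = R.+-congʳ (R.*-comm _ _)
  *-comm s t (suc n) = begin
    s 0 R.* t (suc n) R.+ (tail s * t) n  ≈⟨ R.+-cong (R.*-comm _ _) (*-comm (tail s) t n) ⟩
    t (suc n) R.* s 0 R.+ (t * tail s) n  ≈⟨ *-suc t s n ⟨
    (t * s) (suc n)                       ∎

  *-assoc : ∀ s t u → ((s * t) * u) ≈ (s * (t * u))
  *-assoc s t u zero = R.+-congʳ (begin
    (s 0 R.* t 0 R.+ R.0#) R.* u 0  ≈⟨ R.*-congʳ (R.+-identityʳ _) ⟩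
    s 0 R.* t 0 R.* u 0             ≈⟨ R.*-assoc _ _ _ ⟩
    s 0 R.* (t 0 R.* u 0)           ≈⟨ R.*-congˡ (R.+-identityʳ _) ⟨
    s 0 R.* (t 0 R.* u 0 R.+ R.0#)  ∎)
  -- `tail (s * t)` unfolds to `s 0 · tail t + tail s * t`, so the induction runs on the coefficient
  -- index with `s` replaced by its tail.
  *-assoc s t u (suc n) = begin
    (s 0 R.* t 0 R.+ R.0#) R.* u (suc n) R.+ ((s 0 · tail t + tail s * t) * u) n
      ≈⟨ R.+-cong (R.*-congʳ (R.+-identityʳ _)) (*-distribʳ u (s 0 · tail t) (tail s * t) n) ⟩
    s 0 R.* t 0 R.* u (suc n) R.+ ((s 0 · tail t * u) n R.+ (tail s * t * u) n)
      ≈⟨ R.+-cong (R.*-assoc _ _ _)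
           (R.+-cong (·-*-assoc (s 0) (tail t) u n) (*-assoc (tail s) t u n)) ⟩
    s 0 R.* (t 0 R.* u (suc n)) R.+ (s 0 R.* (tail t * u) n R.+ (tail s * (t * u)) n)
      ≈⟨ R.+-assoc _ _ _ ⟨
    s 0 R.* (t 0 R.* u (suc n)) R.+ s 0 R.* (tail t * u) n R.+ (tail s * (t * u)) n
      ≈⟨ R.+-congʳ (R.distribˡ _ _ _) ⟨
    (s * (t * u)) (suc n) ∎

  constant-* : ∀ p s → (constant p * s) ≈ (p · s)
  constant-* p s zero    = R.+-identityʳ _
  constant-* p s (suc n) = R.trans (R.+-congˡ (*-zeroˡ s n)) (R.+-identityʳ _)

  *-identityˡ : ∀ s → (1# * s) ≈ s
  *-identityˡ s n = R.trans (constant-* R.1# s n) (R.*-identityˡ _)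

  private
    ≈-isEquivalence : IsEquivalence _≈_
    ≈-isEquivalence = record
      { refl  = λ n → R.refl
      ; sym   = λ s≈t n → R.sym (s≈t n)
      ; trans = λ s≈t t≈u n → R.trans (s≈t n) (t≈u n)
      }

  commutativeSemiring : CommutativeSemiring c ℓ
  commutativeSemiring = record
    { isCommutativeSemiring = isCommutativeSemiringˡ record
      { +-isCommutativeMonoid = record
        { isMonoid = record
          { isSemigroup = record
            { isMagma = record
              { isEquivalence = ≈-isEquivalence
              ; ∙-cong = λ s≈s′ t≈t′ n → R.+-cong (s≈s′ n) (t≈t′ n)
              }
            ; assoc = λ s t u n → R.+-assoc _ _ _
            }
          ; identity = (λ s n → R.+-identityˡ _) , (λ s n → R.+-identityʳ _)
          }
        ; comm = λ s t n → R.+-comm _ _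
        }
      ; *-isCommutativeMonoid = record
        { isMonoid = record
          { isSemigroup = record
            { isMagma = record
              { isEquivalence = ≈-isEquivalence
              ; ∙-cong = *-cong
              }
            ; assoc = *-assoc
            }
          ; identity = *-identityˡ , λ s n → R.trans (*-comm s 1# n) (*-identityˡ s n)
          }
        ; comm = *-comm
        }
      ; distribʳ = *-distribʳ
      ; zeroˡ = *-zeroˡ
      }
    }

  -- Multiplication by x and substitution of p x for x

  X*-zero : ∀ s → (X * s) 0 R.≈ R.0#
  X*-zero s = R.trans (R.+-identityʳ _) (R.zeroˡ _)

  X*-suc : ∀ s n → (X * s) (suc n) R.≈ s n
  X*-suc s n = begin
    R.0# R.* s (suc n) R.+ (tail X * s) n
      ≈⟨ R.+-cong (R.zeroˡ _) (*-cong {t = s} tailX (λ _ → R.refl) n) ⟩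
    R.0# R.+ (1# * s) n                    ≈⟨ R.+-identityˡ _ ⟩
    (1# * s) n                             ≈⟨ *-identityˡ s n ⟩
    s n                                    ∎
    where
    tailX : tail X ≈ 1#
    tailX zero    = R.refl
    tailX (suc n) = R.refl

  X^*-zero : ∀ k s {n} → n < k → ((X ^ k) * s) n R.≈ R.0#
  X^*-zero (suc k) s {zero}  _         = R.trans (*-assoc X (X ^ k) s 0) (X*-zero ((X ^ k) * s))
  X^*-zero (suc k) s {suc n} (s≤s n<k) = R.trans (*-assoc X (X ^ k) s (suc n))
    (R.trans (X*-suc ((X ^ k) * s) n) (X^*-zero k s n<k))

  [·X]-cong : ∀ p {s t} → s ≈ t → (s [ p ·X]) ≈ (t [ p ·X])
  [·X]-cong p s≈t n = R.*-congˡ (s≈t n)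

  [·X]-cong₂ : ∀ {p q} → p R.≈ q → ∀ s → (s [ p ·X]) ≈ (s [ q ·X])
  [·X]-cong₂ p≈q s n = R.*-congʳ (^-congˡ n p≈q)

  [·X]-+ : ∀ p s t → ((s + t) [ p ·X]) ≈ ((s [ p ·X]) + (t [ p ·X]))
  [·X]-+ p s t n = R.distribˡ _ _ _

  tail-[·X] : ∀ p s → tail (s [ p ·X]) ≈ (p · (tail s [ p ·X]))
  tail-[·X] p s n = R.*-assoc _ _ _

  -- Substitution commutes with `tail` up to a factor `p`. Induction through `tail` therefore works
  -- without writing the n-th power of `p` as a product of its i-th and (n - i)-th powers under the
  -- sum.
  [·X]-* : ∀ p s t → ((s * t) [ p ·X]) ≈ ((s [ p ·X]) * (t [ p ·X]))
  [·X]-* p s t zero = begin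
    R.1# R.* (s 0 R.* t 0 R.+ R.0#)
      ≈⟨ R.*-identityˡ _ ⟩
    s 0 R.* t 0 R.+ R.0#
      ≈⟨ R.+-congʳ (R.*-cong (R.*-identityˡ _) (R.*-identityˡ _)) ⟨
    R.1# R.* s 0 R.* (R.1# R.* t 0) R.+ R.0# ∎
  [·X]-* p s t (suc n) = begin
    pⁿ⁺¹ R.* (s 0 R.* t (suc n) R.+ (tail s * t) n)
      ≈⟨ R.distribˡ _ _ _ ⟩
    pⁿ⁺¹ R.* (s 0 R.* t (suc n)) R.+ pⁿ⁺¹ R.* (tail s * t) n
      ≈⟨ R.+-cong (x∙yz≈y∙xz _ _ _) (R.*-assoc _ _ _) ⟩
    s 0 R.* (pⁿ⁺¹ R.* t (suc n)) R.+ p R.* ((tail s * t) [ p ·X]) n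
      ≈⟨ R.+-cong (R.*-congʳ (R.*-identityˡ _)) (R.*-congˡ (R.sym ([·X]-* p (tail s) t n))) ⟨
    R.1# R.* s 0 R.* (pⁿ⁺¹ R.* t (suc n)) R.+ p R.* ((tail s [ p ·X]) * (t [ p ·X])) n
      ≈⟨ R.+-congˡ (·-*-assoc p (tail s [ p ·X]) (t [ p ·X]) n) ⟨
    R.1# R.* s 0 R.* (pⁿ⁺¹ R.* t (suc n)) R.+ ((p · (tail s [ p ·X])) * (t [ p ·X])) n
      ≈⟨ R.+-congˡ (*-cong {t = t [ p ·X]} (tail-[·X] p s) (λ _ → R.refl) n) ⟨
    ((s [ p ·X]) * (t [ p ·X])) (suc n) ∎
    where
    pⁿ⁺¹ = p ^ᴿ suc n
    open CommutativeSemigroupProperties R.*-commutativeSemigroup using (x∙yz≈y∙xz)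

  [·X]-1 : ∀ p → (1# [ p ·X]) ≈ 1#
  [·X]-1 p zero    = R.*-identityˡ _
  [·X]-1 p (suc n) = R.zeroʳ _

  X-[·X] : ∀ p → (X [ p ·X]) ≈ (constant p * X)
  X-[·X] p n = R.trans (go n) (R.sym (constant-* p X n))
    where
    go : ∀ n → (X [ p ·X]) n R.≈ (p · X) n
    go 0             = R.trans (R.zeroʳ _) (R.sym (R.zeroʳ _))
    go 1             = R.*-congʳ (R.*-identityʳ _)
    go (suc (suc n)) = R.trans (R.zeroʳ _) (R.sym (R.zeroʳ _))

  [1·X] : ∀ s → (s [ R.1# ·X]) ≈ s
  [1·X] s n = R.trans (R.*-congʳ (1^ n)) (R.*-identityˡ _)
    where
    1^ : ∀ n → R.1# ^ᴿ n R.≈ R.1#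
    1^ zero    = R.refl
    1^ (suc n) = R.trans (R.*-identityˡ _) (1^ n)

  [·X]-[·X] : ∀ p q s → ((s [ p ·X]) [ q ·X]) ≈ (s [ q R.* p ·X])
  [·X]-[·X] p q s n = R.trans (R.sym (R.*-assoc _ _ _)) (R.*-congʳ (R.sym (^-distrib-* q p n)))

  constant-cong : ∀ {p q} → p R.≈ q → constant p ≈ constant q
  constant-cong p≈q zero    = p≈q
  constant-cong p≈q (suc n) = R.refl

  constant-homo-* : ∀ p q → constant (p R.* q) ≈ (constant p * constant q)
  constant-homo-* p q n = R.trans (go n) (R.sym (constant-* p (constant q) n))
    where
    go : ∀ n → constant (p R.* q) n R.≈ (p · constant q) n
    go zero    = R.refl
    go (suc n) = R.sym (R.zeroʳ _)

  sum-coefficient : ∀ {m} t n → sumˢ {m} t n R.≈ S.sum (λ i → t i n)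
  sum-coefficient {zero}  t n = R.refl
  sum-coefficient {suc m} t n = R.+-congˡ (sum-coefficient (t ∘ suc) n)

-- Iterating the functional equation

-- Stated for a monoid because the iteration needs it additively for the partial sums and
-- multiplicatively for the products of the `f j`.
sum-last : ∀ {c ℓ} (M : Monoid c ℓ) → let open Monoid M; open MonoidSum M in
           ∀ (f : ℕ → Carrier) n →
           sum {n = suc n} (f ∘ toℕ) ≈ sum {n = n} (f ∘ toℕ) ∙ f n
sum-last M f n = trans (sum-init-last {n} (f ∘ toℕ)) (∙-cong
    (reflexive (sum-cong-≗ {n} (λ i → ≡.cong f (Fin.toℕ-inject₁ i))))
    (reflexive (≡.cong f (Fin.toℕ-fromℕ n))))
  where
  open Monoid M
  open MonoidSum M

module Iteration {c ℓ} (R : CommutativeSemiring c ℓ) where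
  open CommutativeSemiring R
  open SemiringOps rawSemiring using (sum; product; _^_)

  -- In the application φ = F(x), f d = F(xyᵈ), g d = G(xyᵈ), b d = yᵈ and a d = y^(d C 2).
  module _ (x φ : Carrier) (a b f g : ℕ → Carrier)
    (a₀≈1 : a 0 ≈ 1#)
    (a-suc : ∀ d → a (suc d) ≈ a d * b d)
    (g-step : ∀ d → g d ≈ 1# + b d * x * f d * g (suc d))
    where

    term : ℕ → Carrier
    term d = x ^ suc d * a d * φ * product {n = d} (f ∘ toℕ)

    open ≈-Reasoning setoid
    open CommutativeMonoidSolver *-commutativeMonoid

    term₀ : term 0 ≈ x * φ
    term₀ = begin
      x * 1# * a 0 * φ * 1#  ≈⟨ *-identityʳ _ ⟩
      x * 1# * a 0 * φ       ≈⟨ *-congʳ (*-cong (*-identityʳ x) a₀≈1) ⟩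
      x * 1# * φ             ≈⟨ *-congʳ (*-identityʳ x) ⟩
      x * φ                  ∎

    -- Each new factor has its place: `x` raises the power, `b d` turns `a d` into `a (suc d)`, and
    -- `f d` extends the product.
    term-suc : ∀ d → term d * (b d * x * f d * g (suc d)) ≈ term (suc d) * g (suc d)
    term-suc d = begin
      term d * (b d * x * f d * g (suc d))
        ≈⟨ solve 8 (λ x xᵈ a φ p b f g → (((xᵈ ⊕ a) ⊕ φ) ⊕ p) ⊕ (((b ⊕ x) ⊕ f) ⊕ g)
                     ⊜ ((((x ⊕ xᵈ) ⊕ (a ⊕ b)) ⊕ φ) ⊕ (p ⊕ f)) ⊕ g)
             refl x (x ^ suc d) (a d) φ (product {n = d} (f ∘ toℕ)) (b d) (f d) (g (suc d)) ⟩
      x ^ suc (suc d) * (a d * b d) * φ * (product {n = d} (f ∘ toℕ) * f d) * g (suc d)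
        ≈⟨ *-congʳ (*-cong (*-congʳ (*-congˡ (a-suc d))) (sum-last *-monoid f d)) ⟨
      term (suc d) * g (suc d) ∎

    -- Each use of `g-step` on the remainder splits off one more term. The identity is purely
    -- algebraic, so it holds in any commutative semiring and needs no notion of convergence.
    iterate : ∀ N → x * φ * g 0 ≈ sum {n = N} (term ∘ toℕ) + term N * g N
    iterate zero    = trans (*-congʳ (sym term₀)) (sym (+-identityˡ _))
    iterate (suc N) = begin
      x * φ * g 0
        ≈⟨ iterate N ⟩
      ∑N + term N * g N
        ≈⟨ +-congˡ (*-congˡ (g-step N)) ⟩
      ∑N + term N * (1# + b N * x * f N * g (suc N))
        ≈⟨ +-congˡ (distribˡ _ _ _) ⟩
      ∑N + (term N * 1# + term N * (b N * x * f N * g (suc N)))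
        ≈⟨ +-congˡ (+-cong (*-identityʳ _) (term-suc N)) ⟩
      ∑N + (term N + term (suc N) * g (suc N))
        ≈⟨ +-assoc _ _ _ ⟨
      ∑N + term N + term (suc N) * g (suc N)
        ≈⟨ +-congʳ (sum-last +-monoid term N) ⟨
      sum {n = suc N} (term ∘ toℕ) + term (suc N) * g (suc N) ∎
      where ∑N = sum {n = N} (term ∘ toℕ)

-- Weighted enumeration of lists

module Weights {c ℓ : Level} (R : CommutativeSemiring c ℓ) {A : Set} where
  open CommutativeSemiring R hiding (zero)
  open SemiringOps rawSemiring using (sum)
  open ≈-Reasoning setoid
  open CommutativeSemigroupProperties +-commutativeSemigroup using (x∙yz≈y∙xz)

  weight : (A → Carrier) → List A → Carrier
  weight f []       = 0#
  weight f (x ∷ xs) = f x + weight f xs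

  weight-↭ : ∀ f {xs ys} → xs ↭ ys → weight f xs ≈ weight f ys
  weight-↭ f ↭.refl          = refl
  weight-↭ f (↭.prep x p)    = +-congˡ (weight-↭ f p)
  weight-↭ f (↭.swap x y p)  = trans (+-congˡ (+-congˡ (weight-↭ f p))) (x∙yz≈y∙xz _ _ _)
  weight-↭ f (↭.trans p₁ p₂) = trans (weight-↭ f p₁) (weight-↭ f p₂)

  weight-++ : ∀ f xs ys → weight f (xs ++ ys) ≈ weight f xs + weight f ys
  weight-++ f []       ys = sym (+-identityˡ _)
  weight-++ f (x ∷ xs) ys = trans (+-congˡ (weight-++ f xs ys)) (sym (+-assoc _ _ _))

  weight-concat-tabulate : ∀ f {n} (xss : Fin n → List A) →
                           weight f (concat (tabulate xss)) ≈ sum (λ i → weight f (xss i))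
  weight-concat-tabulate f {zero}  xss = refl
  weight-concat-tabulate f {suc n} xss =
    trans (weight-++ f (xss zero) _) (+-congˡ (weight-concat-tabulate f (xss ∘ suc)))

  weight-*ˡ : ∀ f p xs → weight (λ x → p * f x) xs ≈ p * weight f xs
  weight-*ˡ f p []       = sym (zeroʳ p)
  weight-*ˡ f p (x ∷ xs) = trans (+-congˡ (weight-*ˡ f p xs)) (sym (distribˡ p _ _))

  weight-cong : ∀ {f g} {xs} → All (λ x → f x ≈ g x) xs → weight f xs ≈ weight g xs
  weight-cong []         = refl
  weight-cong (eq ∷ eqs) = +-cong eq (weight-cong eqs)

  weight-map : ∀ f (g : A → A) xs → weight f (map g xs) ≡ weight (f ∘ g) xs
  weight-map f g []       = ≡.refl
  weight-map f g (x ∷ xs) = ≡.cong (f (g x) +_) (weight-map f g xs)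

  -- The factorization is assumed only for second arguments taken from `ys`: for `glue β α` it
  -- relies on the letters of `α` being below its length, whereas `β` may be arbitrary.
  weight-cartesianProductWith : ∀ f g h (_·_ : A → A → A) xs {ys} →
    All (λ y → ∀ x → f (x · y) ≈ g x * h y) ys →
    weight f (cartesianProductWith _·_ xs ys) ≈ weight g xs * weight h ys
  weight-cartesianProductWith f g h _·_ []       {ys} eq = sym (zeroˡ _)
  weight-cartesianProductWith f g h _·_ (x ∷ xs) {ys} eq = begin
    weight f (map (x ·_) ys ++ cartesianProductWith _·_ xs ys)
      ≈⟨ weight-++ f (map (x ·_) ys) _ ⟩
    weight f (map (x ·_) ys) + weight f (cartesianProductWith _·_ xs ys)
      ≈⟨ +-cong (reflexive (weight-map f (x ·_) ys)) (weight-cartesianProductWith f g h _·_ xs eq) ⟩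
    weight (f ∘ (x ·_)) ys + weight g xs * weight h ys
      ≈⟨ +-congʳ (trans (weight-cong (All.map (λ e → e x) eq)) (weight-*ˡ h (g x) ys)) ⟩
    g x * weight h ys + weight g xs * weight h ys
      ≈⟨ distribʳ _ _ _ ⟨
    (g x + weight g xs) * weight h ys ∎

-- Permutations as words over ℕ

module Words where
  open Defs using (words; S; unique?; occurs132?; occurrence1-23?; occurrences1-23)
  open import Data.Nat.Base using (_+_)
  open import Data.Nat.Properties
  open ≡

  private
    variable
      A B : Set
      m n k : ℕ

  -- The pieces of a decomposed permutation have other lengths and other alphabets than the whole.
  -- As lists of naturals they can be cut, shifted and joined within a single type.
  word : Vec (Fin m) k → List ℕ
  word v = map toℕ (Vec.toList v)

  All-word⁺ : {P : ℕ → Set} (v : Vec (Fin m) k) → (∀ i → P (toℕ (lookup v i))) → All P (word v)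
  All-word⁺ []      p = []
  All-word⁺ (x ∷ v) p = p zero ∷ All-word⁺ v (p ∘ suc)

  All-word⁻ : {P : ℕ → Set} (v : Vec (Fin m) k) → All P (word v) → ∀ i → P (toℕ (lookup v i))
  All-word⁻ (x ∷ v) (px ∷ pv) zero    = px
  All-word⁻ (x ∷ v) (px ∷ pv) (suc i) = All-word⁻ v pv i

  AllPairs-word⁺ : {R : ℕ → ℕ → Set} (v : Vec (Fin m) k) →
                   (∀ i j → i Fin.< j → R (toℕ (lookup v i)) (toℕ (lookup v j))) →
                   AllPairs R (word v)
  AllPairs-word⁺ []      r = []
  AllPairs-word⁺ (x ∷ v) r =
    All-word⁺ v (λ j → r zero (suc j) z<s) ∷
    AllPairs-word⁺ v (λ i j i<j → r (suc i) (suc j) (s<s i<j))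

  AllPairs-word⁻ : {R : ℕ → ℕ → Set} (v : Vec (Fin m) k) → AllPairs R (word v) →
                   ∀ i j → i Fin.< j → R (toℕ (lookup v i)) (toℕ (lookup v j))
  AllPairs-word⁻ (x ∷ v) (rx ∷ rv) zero    (suc j) _   = All-word⁻ v rx j
  AllPairs-word⁻ (x ∷ v) (rx ∷ rv) (suc i) (suc j) i<j = AllPairs-word⁻ v rv i j (s<s⁻¹ i<j)

  length-word : (v : Vec (Fin m) k) → length (word v) ≡ k
  length-word []      = refl
  length-word (x ∷ v) = cong suc (length-word v)

  word-injective : {v w : Vec (Fin m) k} → word v ≡ word w → v ≡ w
  word-injective {v = []}    {[]}    _  = refl
  word-injective {v = x ∷ v} {y ∷ w} eq =
    cong₂ _∷_ (Fin.toℕ-injective (∷-injectiveˡ eq)) (word-injective (∷-injectiveʳ eq))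

  word-surjective : ∀ w → All (_< m) w → ∃[ v ] word {m} {length w} v ≡ w
  word-surjective []      []          = [] , refl
  word-surjective (x ∷ w) (x<m ∷ w<m) with word-surjective w w<m
  ... | v , eq = fromℕ< x<m ∷ v , cong₂ _∷_ (Fin.toℕ-fromℕ< x<m) eq

  Unique-word⁺ : (v : Vec (Fin m) k) → Vec.Unique v → Unique (word v)
  Unique-word⁺ v v! = AllPairs-word⁺ v λ i j i<j eq →
    <⇒≢ i<j (cong toℕ (VecUnique.lookup-injective v! i j (Fin.toℕ-injective eq)))

  Unique-word⁻ : (v : Vec (Fin m) k) → Unique (word v) → Vec.Unique v
  Unique-word⁻ []      _         = VecAllPairs.[]
  Unique-word⁻ (x ∷ v) (x∉v ∷ v!) = go v x∉v VecAllPairs.∷ Unique-word⁻ v v!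
    where
    go : ∀ {k} (v : Vec (Fin _) k) → All (toℕ x ≢_) (word v) → VecAll.All (x ≢_) v
    go []      _            = VecAll.[]
    go (y ∷ v) (x≢y ∷ x∉v) = (λ x≡y → x≢y (cong toℕ x≡y)) VecAll.∷ go v x∉v

  -- The pigeonhole principle: looking up letters is an injection from positions to letters.
  Unique-length≤ : ∀ {w} → Unique w → All (_< m) w → length w ≤ m
  Unique-length≤ {w = w} w! w<m with word-surjective w w<m
  ... | v , eq = Fin.injective⇒≤ λ {i} {j} →
    VecUnique.lookup-injective (Unique-word⁻ v (subst Unique (sym eq) w!)) i j

  -- Avoidance of 1-3-2

  -- The recursion is on the letter playing 1, which leaves a condition on pairs in the rest of the
  -- word and makes concatenation accessible to structural induction.
  Avoiding : List ℕ → Set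
  Avoiding []      = ⊤
  Avoiding (a ∷ w) = AllPairs (λ b c → ¬ (a < c × c < b)) w × Avoiding w

  -- `Occurs132` with the length freed from the alphabet size, so that an induction can drop the
  -- first letter; at `k = m` the two unfold to the same type.
  OccursIn : Vec (Fin m) k → Set
  OccursIn π = ∃[ a ] ∃[ b ] ∃[ c ]
    a Fin.< b × b Fin.< c × lookup π a Fin.< lookup π c × lookup π c Fin.< lookup π b

  avoiding⁺ : (v : Vec (Fin m) k) → ¬ OccursIn v → Avoiding (word v)
  avoiding⁺ []      _    = tt
  avoiding⁺ (x ∷ v) ¬occ =
    AllPairs-word⁺ v (λ i j i<j (x<c , c<b) →
      ¬occ (zero , suc i , suc j , z<s , s<s i<j , x<c , c<b)) ,
    avoiding⁺ v λ (a , b , c , a<b , b<c , rest) →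
      ¬occ (suc a , suc b , suc c , s<s a<b , s<s b<c , rest)

  avoiding⁻ : (v : Vec (Fin m) k) → Avoiding (word v) → ¬ OccursIn v
  avoiding⁻ (x ∷ v) (p , _) (zero , suc b , suc c , _ , b<c , rest) =
    AllPairs-word⁻ v p b c (s<s⁻¹ b<c) rest
  avoiding⁻ (x ∷ v) (_ , q) (suc a , suc b , suc c , a<b , b<c , rest) =
    avoiding⁻ v q (a , b , c , s<s⁻¹ a<b , s<s⁻¹ b<c , rest)

  AllPairs-++⁻ : {R : A → A → Set} (xs : List A) {ys : List A} → AllPairs R (xs ++ ys) →
                 AllPairs R xs × AllPairs R ys × All (λ x → All (R x) ys) xs
  AllPairs-++⁻ []       rs       = [] , rs , []
  AllPairs-++⁻ (x ∷ xs) (r ∷ rs) with AllPairs-++⁻ xs rs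
  ... | rxs , rys , rxsys = All.++⁻ˡ xs r ∷ rxs , rys , All.++⁻ʳ xs r ∷ rxsys

  -- If the 1 lies in `u`, the 2 exceeds it and so cannot lie in `v`. The 2 comes last, hence the
  -- whole occurrence lies in `u`.
  avoiding-++⁺ : ∀ {u v} → Avoiding u → Avoiding v → All (λ a → All (_≤ a) v) u → Avoiding (u ++ v)
  avoiding-++⁺ {[]}    _       av []             = av
  avoiding-++⁺ {a ∷ u} (p , q) av (a≥v ∷ u≥v) =
    AllPairs.++⁺ p (weaken a≥v)
      (All.universal (λ b → All.map (λ c≤a (a<c , _) → <⇒≱ a<c c≤a) a≥v) u) ,
    avoiding-++⁺ q av u≥v
    where
    weaken : ∀ {w} → All (_≤ a) w → AllPairs (λ b c → ¬ (a < c × c < b)) w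
    weaken []           = []
    weaken (b≤a ∷ w≤a) =
      All.map (λ c≤a (a<c , _) → <⇒≱ a<c c≤a) w≤a ∷ weaken w≤a

  -- A final letter could only play the 2, but then some earlier letter would have to exceed it.
  avoiding-∷ʳ⁺ : ∀ {u z} → Avoiding u → All (_< z) u → Avoiding (u ∷ʳ z)
  avoiding-∷ʳ⁺ {[]}    _       []          = [] , tt
  avoiding-∷ʳ⁺ {a ∷ u} (p , q) (_ ∷ u<z) =
    AllPairs.++⁺ p ([] ∷ []) (All.map (λ b<z → (λ (_ , z<b) → <-asym b<z z<b) ∷ []) u<z) ,
    avoiding-∷ʳ⁺ q u<z

  avoiding-++⁻ : ∀ u {v} → Avoiding (u ++ v) → Avoiding u × Avoiding v
  avoiding-++⁻ []      av      = tt , av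
  avoiding-++⁻ (a ∷ u) (p , q) with avoiding-++⁻ u q
  ... | au , av = (proj₁ (AllPairs-++⁻ u p) , au) , av

  avoiding-∷ʳ⁻ : ∀ u {z} → Avoiding (u ∷ʳ z) → AllPairs (λ a b → ¬ (a < z × z < b)) u
  avoiding-∷ʳ⁻ []      _       = []
  avoiding-∷ʳ⁻ (a ∷ u) (p , q) =
    All.map All.head (proj₂ (proj₂ (AllPairs-++⁻ u p))) ∷ avoiding-∷ʳ⁻ u q

  avoiding-shift⁺ : ∀ k {w} → Avoiding w → Avoiding (map (k +_) w)
  avoiding-shift⁺ k {[]}    _       = tt
  avoiding-shift⁺ k {a ∷ w} (p , q) =
    AllPairs.map⁺ (AllPairs.map (λ ¬ac (l , r) →
      ¬ac (+-cancelˡ-< k _ _ l , +-cancelˡ-< k _ _ r)) p) ,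
    avoiding-shift⁺ k q

  avoiding-shift⁻ : ∀ k {w} → Avoiding (map (k +_) w) → Avoiding w
  avoiding-shift⁻ k {[]}    _       = tt
  avoiding-shift⁻ k {a ∷ w} (p , q) =
    AllPairs.map (λ ¬ac (l , r) → ¬ac (+-monoʳ-< k l , +-monoʳ-< k r)) (AllPairs.map⁻ p) ,
    avoiding-shift⁻ k q

  -- Decomposition at the last letter

  AvoidingPermutation : ℕ → List ℕ → Set
  AvoidingPermutation n w = length w ≡ n × All (_< n) w × Unique w × Avoiding w

  avoiders : ∀ n → List (List ℕ)
  avoiders n = map word (filter (λ π → ¬? (occurs132? π)) (S n))

  words-complete : (w : Vec (Fin n) k) → w ∈ words k n
  words-complete []      = Any.singleton⁺ refl
  words-complete (x ∷ w) = ∈-cartesianProductWith⁺ Vec._∷_ (∈-allFin x) (words-complete w)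

  words-unique : ∀ k n → Unique (words k n)
  words-unique zero    n = [] ∷ []
  words-unique (suc k) n =
    Unique.cartesianProductWith⁺ Vec._∷_ Vec.∷-injective (Unique.allFin⁺ n) (words-unique k n)

  avoiders-unique : ∀ n → Unique (avoiders n)
  avoiders-unique n = Unique.map⁺ word-injective
    (Unique.filter⁺ _ (Unique.filter⁺ unique? (words-unique n n)))

  ∈-avoiders⁻ : ∀ {w} → w ∈ avoiders n → AvoidingPermutation n w
  ∈-avoiders⁻ {n} w∈ with ∈-map⁻ word w∈
  ... | π , π∈ , refl with ∈-filter⁻ (λ π → ¬? (occurs132? π)) {xs = S n} π∈
  ... | π∈S , ¬occ =
    length-word π , All-word⁺ π (λ i → Fin.toℕ<n (lookup π i)) ,
    Unique-word⁺ π (proj₂ (∈-filter⁻ unique? {xs = words n n} π∈S)) , avoiding⁺ π ¬occ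

  ∈-avoiders⁺ : ∀ {w} → AvoidingPermutation n w → w ∈ avoiders n
  ∈-avoiders⁺ {w = w} (refl , w<n , w! , av) with word-surjective w w<n
  ... | π , eq = subst (_∈ avoiders (length w)) eq (∈-map⁺ word (∈-filter⁺ (λ π → ¬? (occurs132? π))
    (∈-filter⁺ unique? (words-complete π) (Unique-word⁻ π (subst Unique (sym eq) w!)))
    (avoiding⁻ π (subst Avoiding (sym eq) av))))

  -- With letters numbered from 0, this is the one-line notation of β ⊖ (α ⊕ 1).
  glue : List ℕ → List ℕ → List ℕ
  glue β α = (map (suc (length α) +_) β ++ α) ∷ʳ length α

  glue-assoc : ∀ β α → glue β α ≡ map (suc (length α) +_) β ++ (α ∷ʳ length α)
  glue-assoc β α = ++-assoc (map (suc (length α) +_) β) α _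

  ++-injective : ∀ (u : List A) {v u′ v′} → length u ≡ length u′ →
                 u ++ v ≡ u′ ++ v′ → u ≡ u′ × v ≡ v′
  ++-injective []      {u′ = []}     _   eq = refl , eq
  ++-injective (x ∷ u) {u′ = y ∷ u′} len eq
    with ++-injective u (suc-injective len) (∷-injectiveʳ eq)
  ... | u≡u′ , v≡v′ = cong₂ _∷_ (∷-injectiveˡ eq) u≡u′ , v≡v′

  -- The last letter records the length of `α`, which fixes both the place of the cut and the amount
  -- of the shift.
  glue-injective : ∀ {β β′ α α′} → glue β α ≡ glue β′ α′ → β ≡ β′ × α ≡ α′
  glue-injective {β} {β′} {α} {α′} eq with ∷ʳ-injective (map (suc (length α) +_) β ++ α) _ eq
  ... | eq′ , ∣α∣≡∣α′∣
    with ++-injective (map (suc (length α) +_) β) {α} {map (suc (length α′) +_) β′} {α′}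
        (+-cancelʳ-≡ (length α) _ _ (trans (sym (length-++ (map (suc (length α) +_) β)))
          (trans (cong length eq′) (trans (length-++ (map (suc (length α′) +_) β′))
          (cong (length (map (suc (length α′) +_) β′) +_) (sym ∣α∣≡∣α′∣)))))) eq′
  ... | β↑≡β′↑ , refl = map-injective (+-cancelˡ-≡ (suc (length α)) _ _) β↑≡β′↑ , refl

  length-∷ʳ : ∀ (x : A) xs → length (xs ∷ʳ x) ≡ suc (length xs)
  length-∷ʳ x xs = trans (length-++ xs) (+-comm (length xs) 1)

  length-glue : ∀ β α → length (glue β α) ≡ suc (length β + length α)
  length-glue β α = trans (length-∷ʳ _ (map (suc (length α) +_) β ++ α))
    (cong suc (trans (length-++ (map (suc (length α) +_) β)) (cong (_+ length α) (length-map _ β))))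

  glue⁺ : ∀ {i j β α} → AvoidingPermutation i β → AvoidingPermutation j α →
          AvoidingPermutation (suc (i + j)) (glue β α)
  glue⁺ {β = β} {α} (refl , β<i , β! , avβ) (refl , α<j , α! , avα) =
    length-glue β α ,
    All.∷ʳ⁺ (All.++⁺ (All.map⁺ (All.map (λ b<i → s<s (
                       ≤-trans (+-monoʳ-< j b<i) (≤-reflexive (+-comm j i)))) β<i))
                     (All.map (λ a<j → ≤-trans a<j (≤-trans (m≤n+m j i) (n≤1+n _))) α<j))
            (s≤s (m≤n+m j i)) ,
    AllPairs.++⁺
      (AllPairs.++⁺ (Unique.map⁺ (+-cancelˡ-≡ (suc j) _ _) β!) α!
        (All.map (λ j<b → All.map (λ a<j → ≢-sym (<⇒≢ (<-trans a<j j<b))) α<j) big))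
      ([] ∷ [])
      (All.++⁺ (All.map (λ j<b → ≢-sym (<⇒≢ j<b) ∷ []) big) (All.map (λ a<j → <⇒≢ a<j ∷ []) α<j)) ,
    subst Avoiding (sym (glue-assoc β α))
      (avoiding-++⁺ (avoiding-shift⁺ (suc j) avβ) (avoiding-∷ʳ⁺ avα α<j)
        (All.map (λ j<b → All.∷ʳ⁺ (All.map (λ a<j → <⇒≤ (<-trans a<j j<b)) α<j) (<⇒≤ j<b)) big))
    where
    i = length β
    j = length α
    big : All (j <_) (map (suc j +_) β)
    big = All.map⁺ (All.universal (λ b → s≤s (m≤m+n j b)) β)

  -- The cut is made before the first letter `a` below `z`. A later letter above `z` would form a
  -- 1-3-2 with `a` and the final `z`.
  split : ∀ z u → All (_≢ z) u → AllPairs (λ a b → ¬ (a < z × z < b)) u →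
          ∃[ β ] ∃[ α ] u ≡ β ++ α × All (z <_) β × All (_< z) α
  split z []      _          _        = [] , [] , refl , [] , []
  split z (a ∷ u) (a≢z ∷ u≢z) (p ∷ ps) with a <? z
  ... | yes a<z = [] , a ∷ u , refl , [] , a<z ∷
    All.zipWith (λ (b≢z , ¬ab) → ≤∧≢⇒< (≮⇒≥ (λ z<b → ¬ab (a<z , z<b))) b≢z) (u≢z , p)
  ... | no  a≮z with split z u u≢z ps
  ...   | β , α , refl , z<β , α<z = a ∷ β , α , refl , ≤∧≢⇒< (≮⇒≥ a≮z) (≢-sym a≢z) ∷ z<β , α<z

  unshift : ∀ k {w} → All (k ≤_) w → map (k +_) (map (_∸ k) w) ≡ w
  unshift k []           = refl
  unshift k (k≤a ∷ k≤w) = cong₂ _∷_ (m+[n∸m]≡n k≤a) (unshift k k≤w)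

  glue⁻ : ∀ {w} → AvoidingPermutation (suc n) w →
          ∃[ β ] ∃[ α ] w ≡ glue β α ×
          AvoidingPermutation (length β) β × AvoidingPermutation (length α) α
  glue⁻ {n} {w} (∣w∣≡1+n , w<1+n , w! , av) with initLast w
  glue⁻ (() , _) | []
  ... | u ∷ʳ′ z with AllPairs-++⁻ u w!
  ... | u! , _ , u≢z with split z u (All.map All.head u≢z) (avoiding-∷ʳ⁻ u av)
  ... | β↑ , α , refl , z<β , α<z =
    β , α , cong₂ _∷ʳ_ (cong (_++ α) (trans (sym β↑-eq)
                         (cong (λ k → map (suc k +_) β) (sym ∣α∣≡z))))
                       (sym ∣α∣≡z) ,
    (refl , subst (λ k → All (_< k) β) (sym ∣β∣≡n∸z) β<n∸z , β! ,
      avoiding-shift⁻ (suc z) (subst Avoiding (sym β↑-eq) (proj₁ avβα))) ,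
    (refl , subst (λ k → All (_< k) α) (sym ∣α∣≡z) α<z , α! , proj₂ avβα)
    where
    β = map (_∸ suc z) β↑
    β↑-eq : map (suc z +_) β ≡ β↑
    β↑-eq = unshift (suc z) z<β
    avβα = avoiding-++⁻ β↑ (proj₁ (avoiding-++⁻ (β↑ ++ α) av))
    u!′ = AllPairs-++⁻ β↑ u!
    α! = proj₁ (proj₂ u!′)
    β! : Unique β
    β! = Unique.map⁻ (subst Unique (sym β↑-eq) (proj₁ u!′))
    z≤n′ : z ≤ n
    z≤n′ = s≤s⁻¹ (All.head (All.++⁻ʳ (β↑ ++ α) w<1+n))
    β<n∸z : All (_< n ∸ z) β
    β<n∸z = All.map⁺ (All.zipWith (λ (z<b , b<1+n) → ∸-monoˡ-< b<1+n z<b)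
      (z<β , All.++⁻ˡ β↑ (All.++⁻ˡ (β↑ ++ α) w<1+n)))
    total : length β + length α ≡ n
    total = trans (cong (_+ length α) (length-map _ β↑)) (trans (sym (length-++ β↑))
      (suc-injective (trans (sym (length-∷ʳ z (β↑ ++ α))) ∣w∣≡1+n)))
    -- Two pigeonhole bounds, `n ∸ z` and `z`, whose sum is the exact total `n`; hence both are
    -- equalities. In particular the last letter is the length of `α`.
    ∣β∣≤ : length β ≤ n ∸ z
    ∣β∣≤ = Unique-length≤ β! β<n∸z
    ∣α∣≤ : length α ≤ z
    ∣α∣≤ = Unique-length≤ α! α<z
    ∣α∣≡z : length α ≡ z
    ∣α∣≡z = ≤-antisym ∣α∣≤ (+-cancelˡ-≤ (n ∸ z) _ _ (≤-trans
      (≤-reflexive (trans (m∸n+n≡m z≤n′) (sym total))) (+-monoˡ-≤ (length α) ∣β∣≤)))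
    ∣β∣≡n∸z : length β ≡ n ∸ z
    ∣β∣≡n∸z = trans (sym (m+n∸n≡m (length β) (length α))) (cong₂ _∸_ total ∣α∣≡z)

  -- Neither list has repetitions, so having the same members is enough. A word cannot lie in two
  -- blocks because `glue-injective` recovers `β`, whose length is the index of the block.
  avoiders-suc : ∀ n → avoiders (suc n) ↭
    concat (tabulate {n = suc n} λ i →
      cartesianProductWith glue (avoiders (toℕ i)) (avoiders (n ∸ toℕ i)))
  avoiders-suc n = ∼bag⇒↭ (unique∧set⇒bag (avoiders-unique (suc n)) blocks-unique (mk⇔ to from))
    where
    block : Fin (suc n) → List (List ℕ)
    block i = cartesianProductWith glue (avoiders (toℕ i)) (avoiders (n ∸ toℕ i))

    ∈-block⁻ : ∀ i {w} → w ∈ block i →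
      ∃[ β ] ∃[ α ] AvoidingPermutation (toℕ i) β × AvoidingPermutation (n ∸ toℕ i) α × w ≡ glue β α
    ∈-block⁻ i w∈ with ∈-cartesianProductWith⁻ glue (avoiders (toℕ i)) (avoiders (n ∸ toℕ i)) w∈
    ... | β , α , β∈ , α∈ , eq = β , α , ∈-avoiders⁻ β∈ , ∈-avoiders⁻ α∈ , eq

    blocks-unique : Unique (concat (tabulate block))
    blocks-unique = Unique.concat⁺
      (All.tabulate⁺ {f = block} λ i → Unique.cartesianProductWith⁺ glue
        (λ {β} {β′} {α} {α′} → glue-injective {β} {β′} {α} {α′})
        (avoiders-unique (toℕ i)) (avoiders-unique (n ∸ toℕ i)))
      (AllPairs.tabulate⁺ {f = block} λ {i} {j} i≢j (w∈i , w∈j) → disjoint i j i≢j w∈i w∈j)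
      where
      disjoint : ∀ i j → i ≢ j → ∀ {w} → w ∈ block i → ¬ w ∈ block j
      disjoint i j i≢j w∈i w∈j with ∈-block⁻ i w∈i | ∈-block⁻ j w∈j
      ... | β , α , (∣β∣≡i , _) , _ , eq | β′ , α′ , (∣β′∣≡j , _) , _ , eq′
        with glue-injective {β} {β′} {α} {α′} (trans (sym eq) eq′)
      ... | refl , _ = i≢j (Fin.toℕ-injective (trans (sym ∣β∣≡i) ∣β′∣≡j))

    to : ∀ {w} → w ∈ avoiders (suc n) → w ∈ concat (tabulate block)
    to w∈ with ∈-avoiders⁻ w∈
    ... | perm with glue⁻ perm
    ... | β , α , refl , permβ , permα =
      ∈-concat⁺′ (∈-cartesianProductWith⁺ glue
          (∈-avoiders⁺ (subst (λ k → AvoidingPermutation k β) (sym i≡) permβ))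
          (∈-avoiders⁺ (subst (λ k → AvoidingPermutation k α) (sym j≡) permα)))
        (∈-tabulate⁺ {f = block} i)
      where
      total : length β + length α ≡ n
      total = suc-injective (trans (sym (length-glue β α)) (proj₁ perm))
      i : Fin (suc n)
      i = fromℕ< (s≤s (≤-trans (m≤m+n (length β) (length α)) (≤-reflexive total)))
      i≡ : toℕ i ≡ length β
      i≡ = Fin.toℕ-fromℕ< _
      j≡ : n ∸ toℕ i ≡ length α
      j≡ = trans (cong₂ _∸_ (sym total) i≡) (m+n∸m≡n (length β) (length α))

    from : ∀ {w} → w ∈ concat (tabulate block) → w ∈ avoiders (suc n)
    from w∈ with ∈-concat⁻′ (tabulate block) w∈
    ... | ws , w∈ws , ws∈ with ∈-tabulate⁻ {f = block} ws∈
    ... | i , refl with ∈-block⁻ i w∈ws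
    ... | β , α , permβ , permα , refl = ∈-avoiders⁺ (subst
      (λ k → AvoidingPermutation (suc k) (glue β α))
      (m+[n∸m]≡n (Fin.toℕ≤pred[n] i)) (glue⁺ permβ permα))

  -- Occurrences of 1-23

  indicator : Bool → ℕ
  indicator true  = 1
  indicator false = 0

  -- The list is what follows `b` in the word; when it is empty, `b` has no right neighbour to play
  -- the 3.
  ascentAt : ℕ → ℕ → List ℕ → ℕ
  ascentAt a b []      = 0
  ascentAt a b (c ∷ _) = indicator ((a <ᵇ b) ∧ (b <ᵇ c))

  ascentsAbove : ℕ → List ℕ → ℕ
  ascentsAbove a []      = 0
  ascentsAbove a (b ∷ w) = ascentAt a b w + ascentsAbove a w

  occ : List ℕ → ℕ
  occ []      = 0
  occ (a ∷ w) = ascentsAbove a w + occ w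

  <ᵇ-true : ∀ {a b} → a < b → (a <ᵇ b) ≡ true
  <ᵇ-true {a} {b} = dec-true (a <? b)

  <ᵇ-false : ∀ {a b} → b ≤ a → (a <ᵇ b) ≡ false
  <ᵇ-false {a} {b} b≤a = dec-false (a <? b) (≤⇒≯ b≤a)

  -- An occurrence across the boundary has either its 23 inside `v` or its 2 at the end of `u` and
  -- its 3 at the start of `v`. The two halves of the hypothesis exclude these cases.
  occ-++ : ∀ u v → All (λ a → ascentsAbove a v ≡ 0 × ∀ x → ascentAt x a v ≡ 0) u →
           occ (u ++ v) ≡ occ u + occ v
  occ-++ []      v []            = refl
  occ-++ (a ∷ u) v ((a≡0 , _) ∷ h) = trans
    (cong₂ _+_ (go u h) (occ-++ u v h))
    (sym (+-assoc (ascentsAbove a u) (occ u) (occ v)))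
    where
    go : ∀ u → All (λ a → ascentsAbove a v ≡ 0 × ∀ x → ascentAt x a v ≡ 0) u →
         ascentsAbove a (u ++ v) ≡ ascentsAbove a u
    go []          []            = a≡0
    go (b ∷ [])    ((_ , b≡0) ∷ []) = cong₂ _+_ (b≡0 a) a≡0
    go (b ∷ c ∷ u) (_ ∷ h)       = cong (ascentAt a b (c ∷ u) +_) (go (c ∷ u) h)

  -- The letter `z` may be of any size: standing last it can only play the 3, so the 2 must come
  -- from `w`.
  ascentsAbove-≤ : ∀ {a} w → All (_≤ a) w → ∀ z → ascentsAbove a (w ∷ʳ z) ≡ 0
  ascentsAbove-≤ []      []          z = refl
  ascentsAbove-≤ {a} (b ∷ w) (b≤a ∷ w≤a) z = cong₂ _+_ (go (w ∷ʳ z)) (ascentsAbove-≤ w w≤a z)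
    where
    go : ∀ w → ascentAt a b w ≡ 0
    go []      = refl
    go (c ∷ w) rewrite <ᵇ-false b≤a = refl

  ascentAt-≤ : ∀ {b c} → c ≤ b → ∀ x w → ascentAt x b (c ∷ w) ≡ 0
  ascentAt-≤ {b} c≤b x w rewrite <ᵇ-false c≤b | ∧-zeroʳ (x <ᵇ b) = refl

  ascentsAbove-∷ʳ-∷ʳ : ∀ {a y z} w → a < y → y < z →
                       ascentsAbove a ((w ∷ʳ y) ∷ʳ z) ≡ ascentsAbove a (w ∷ʳ y) + 1
  ascentsAbove-∷ʳ-∷ʳ [] a<y y<z rewrite <ᵇ-true a<y | <ᵇ-true y<z = refl
  ascentsAbove-∷ʳ-∷ʳ {a} {y} {z} (b ∷ w) a<y y<z = trans
    (cong₂ _+_ (go w) (ascentsAbove-∷ʳ-∷ʳ w a<y y<z))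
    (sym (+-assoc (ascentAt a b (w ∷ʳ y)) _ 1))
    where
    go : ∀ w → ascentAt a b ((w ∷ʳ y) ∷ʳ z) ≡ ascentAt a b (w ∷ʳ y)
    go []      = refl
    go (c ∷ w) = refl

  -- The only new 23 is the adjacent pair `y`, `z`, and every letter of `w` is a 1 for it.
  occ-∷ʳ-∷ʳ : ∀ {y z} w → All (_< y) w → y < z → occ ((w ∷ʳ y) ∷ʳ z) ≡ occ (w ∷ʳ y) + length w
  occ-∷ʳ-∷ʳ []      []          y<z = refl
  occ-∷ʳ-∷ʳ {y} {z} (a ∷ w) (a<y ∷ w<y) y<z = trans
    (cong₂ _+_ (ascentsAbove-∷ʳ-∷ʳ w a<y y<z) (occ-∷ʳ-∷ʳ w w<y y<z))
    (interchange (ascentsAbove a (w ∷ʳ y)) 1 (occ (w ∷ʳ y)) (length w))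
    where open CommutativeSemigroupProperties +-commutativeSemigroup using (interchange)

  occ-shift : ∀ k w → occ (map (k +_) w) ≡ occ w
  occ-shift k []      = refl
  occ-shift k (a ∷ w) = cong₂ _+_ (go w) (occ-shift k w)
    where
    <ᵇ-shift : ∀ k a b → (k + a <ᵇ k + b) ≡ (a <ᵇ b)
    <ᵇ-shift zero    a b = refl
    <ᵇ-shift (suc k) a b = <ᵇ-shift k a b
    go : ∀ w → ascentsAbove (k + a) (map (k +_) w) ≡ ascentsAbove a w
    go []          = refl
    go (b ∷ [])    = refl
    go (b ∷ c ∷ w) = cong₂ _+_
      (cong₂ (λ p q → indicator (p ∧ q)) (<ᵇ-shift k a b) (<ᵇ-shift k b c)) (go (c ∷ w))

  -- The letter |w| is larger than all letters of a permutation w of 0, …, |w| − 1, so this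
  -- counts the occurrences in w ⊕ 1.
  occ⁺ : List ℕ → ℕ
  occ⁺ w = occ (w ∷ʳ length w)

  -- The common core of `occ-glue`, where `v` is empty, and `occ⁺-glue`, where `v` is the new
  -- largest letter.
  occ-glue-++ : ∀ β α v → All (_< length α) α →
                (∀ a → length α < a → ascentsAbove a ((α ∷ʳ length α) ++ v) ≡ 0) →
                occ (glue β α ++ v) ≡ occ β + occ ((α ∷ʳ length α) ++ v)
  occ-glue-++ β α v α<j v≡0 = begin
    occ (glue β α ++ v)           ≡⟨ cong (λ w → occ (w ++ v)) (glue-assoc β α) ⟩
    occ ((β↑ ++ α ∷ʳ j) ++ v)     ≡⟨ cong occ (++-assoc β↑ (α ∷ʳ j) v) ⟩
    occ (β↑ ++ (α ∷ʳ j) ++ v)     ≡⟨ occ-++ β↑ _ (All.map⁺ (All.universal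
                                       (λ b → v≡0 _ (big b) , head α α<j b) β)) ⟩
    occ β↑ + occ ((α ∷ʳ j) ++ v)  ≡⟨ cong (_+ occ ((α ∷ʳ j) ++ v))
                                       (occ-shift (suc j) β) ⟩
    occ β + occ ((α ∷ʳ j) ++ v)   ∎
    where
    open ≡-Reasoning
    j = length α
    β↑ = map (suc j +_) β
    big : ∀ b → j < suc j + b
    big b = s≤s (m≤m+n j b)
    -- The letter following the shifted `β` is the first of `α`, or `j` if `α` is empty. Either way
    -- it is a descent, so no 23 straddles the cut.
    head : ∀ α → All (_< j) α → ∀ b x → ascentAt x (suc j + b) ((α ∷ʳ j) ++ v) ≡ 0
    head []      _         b x = ascentAt-≤ (<⇒≤ (big b)) x v
    head (a ∷ α) (a<j ∷ _) b x = ascentAt-≤ (<⇒≤ (<-trans a<j (big b))) x ((α ∷ʳ j) ++ v)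

  occ-glue : ∀ β α → All (_< length α) α → occ (glue β α) ≡ occ β + occ⁺ α
  occ-glue β α α<j = begin
    occ (glue β α)
      ≡⟨ cong occ (++-identityʳ (glue β α)) ⟨
    occ (glue β α ++ [])
      ≡⟨ occ-glue-++ β α [] α<j (λ a j<a → trans
           (cong (ascentsAbove a) (++-identityʳ (α ∷ʳ length α)))
           (ascentsAbove-≤ α (All.map (λ b<j → <⇒≤ (<-trans b<j j<a)) α<j) (length α))) ⟩
    occ β + occ ((α ∷ʳ length α) ++ [])
      ≡⟨ cong (λ w → occ β + occ w) (++-identityʳ (α ∷ʳ length α)) ⟩
    occ β + occ⁺ α ∎
    where open ≡-Reasoning

  occ⁺-glue : ∀ β α → All (_< length α) α → occ⁺ (glue β α) ≡ occ β + (length α + occ⁺ α)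
  occ⁺-glue β α α<j = begin
    occ (glue β α ∷ʳ N)
      ≡⟨ occ-glue-++ β α (N ∷ []) α<j (λ a j<a → ascentsAbove-≤ (α ∷ʳ j)
           (All.∷ʳ⁺ (All.map (λ b<j → <⇒≤ (<-trans b<j j<a)) α<j) (<⇒≤ j<a)) N) ⟩
    occ β + occ ((α ∷ʳ j) ∷ʳ N)
      ≡⟨ cong (occ β +_) (occ-∷ʳ-∷ʳ α α<j j<N) ⟩
    occ β + (occ⁺ α + j)
      ≡⟨ cong (occ β +_) (+-comm (occ⁺ α) j) ⟩
    occ β + (j + occ⁺ α) ∎
    where
    open ≡-Reasoning
    j = length α
    N = length (glue β α)
    j<N : j < N
    j<N = subst (j <_) (sym (length-glue β α)) (s≤s (m≤n+m j (length β)))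

  -- From filtered pairs of positions to the recursive count

  module _ {P : A → Set} {Q : A → Set} (P? : Decidable P) (Q? : Decidable Q) where
    length-filter-cong : (∀ x → does (P? x) ≡ does (Q? x)) → ∀ xs →
                      length (filter P? xs) ≡ length (filter Q? xs)
    length-filter-cong P≡Q []       = refl
    length-filter-cong P≡Q (x ∷ xs) with does (P? x) | does (Q? x) | P≡Q x
    ... | true  | _ | refl = cong suc (length-filter-cong P≡Q xs)
    ... | false | _ | refl = length-filter-cong P≡Q xs

  length-filter-∷ : {P : A → Set} (P? : Decidable P) → ∀ x xs →
                    length (filter P? (x ∷ xs)) ≡ indicator (does (P? x)) + length (filter P? xs)
  length-filter-∷ P? x xs with does (P? x)
  ... | true  = refl
  ... | false = refl

  length-filter-map : {P : B → Set} (P? : Decidable P) (f : A → B) → ∀ xs →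
                      length (filter P? (map f xs)) ≡ length (filter (P? ∘ f) xs)
  length-filter-map P? f []       = refl
  length-filter-map P? f (x ∷ xs) with does (P? (f x))
  ... | true  = cong suc (length-filter-map P? f xs)
  ... | false = length-filter-map P? f xs

  length-filter-cartesianProduct :
    {P : A × B → Set} (P? : Decidable P) → ∀ xs ys →
    length (filter P? (cartesianProduct xs ys)) ≡
    ListAction.sum (map (λ x → length (filter (λ y → P? (x , y)) ys)) xs)
  length-filter-cartesianProduct P? []       ys = refl
  length-filter-cartesianProduct P? (x ∷ xs) ys = begin
    length (filter P? (map (x ,_) ys ++ cartesianProduct xs ys))
      ≡⟨ cong length (filter-++ P? (map (x ,_) ys) _) ⟩
    length (filter P? (map (x ,_) ys) ++ filter P? (cartesianProduct xs ys))
      ≡⟨ length-++ (filter P? (map (x ,_) ys)) ⟩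
    length (filter P? (map (x ,_) ys)) + length (filter P? (cartesianProduct xs ys))
      ≡⟨ cong₂ _+_ (length-filter-map P? (x ,_) ys) (length-filter-cartesianProduct P? xs ys) ⟩
    _ ∎
    where open ≡-Reasoning

  length-filter-× : {P Q : A → Set} (P? : Decidable P) (Q? : Decidable Q) → ∀ xs →
                    length (filter (λ x → P? x ×-dec Q? x) xs) ≡ length (filter Q? (filter P? xs))
  length-filter-× P? Q? []       = refl
  length-filter-× P? Q? (x ∷ xs) with does (P? x)
  ... | false = length-filter-× P? Q? xs
  ... | true with does (Q? x)
  ...   | true  = cong suc (length-filter-× P? Q? xs)
  ...   | false = length-filter-× P? Q? xs

  allFin-suc : ∀ k → allFin (suc k) ≡ zero ∷ map suc (allFin k)
  allFin-suc k = cong (zero ∷_) (sym (map-tabulate id suc))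

  count : {P : Fin k → Set} → Decidable P → ℕ
  count P? = length (filter P? (allFin _))

  count-suc : {P : Fin (suc k) → Set} (P? : Decidable P) →
              count P? ≡ indicator (does (P? zero)) + count (P? ∘ suc)
  count-suc {k} P? = begin
    length (filter P? (allFin (suc k)))             ≡⟨ cong (length ∘ filter P?) (allFin-suc k) ⟩
    length (filter P? (zero ∷ map suc (allFin k)))  ≡⟨ length-filter-∷ P? zero _ ⟩
    indicator (does (P? zero)) + length (filter P? (map suc (allFin k)))
      ≡⟨ cong (indicator (does (P? zero)) +_) (length-filter-map P? suc (allFin k)) ⟩
    indicator (does (P? zero)) + count (P? ∘ suc)         ∎
    where open ≡-Reasoning

  -- The part of `Occurrence1-23` that concerns the 23, with the 1 given by its value instead of its
  -- position. It thus still makes sense after the 1 has been removed from the word.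
  AscentAbove : Fin m → Vec (Fin m) k → Fin k → Set
  AscentAbove x v b = ∃[ b⁺ ] toℕ b⁺ ≡ suc (toℕ b) ×
                             x Fin.< lookup v b × lookup v b Fin.< lookup v b⁺

  ascentAbove? : (x : Fin m) (v : Vec (Fin m) k) → Decidable (AscentAbove x v)
  ascentAbove? x v b = Fin.any? λ b⁺ →
    toℕ b⁺ ≟ suc (toℕ b) ×-dec x Fin.<? lookup v b ×-dec lookup v b Fin.<? lookup v b⁺

  ascentAbove-suc : {x y : Fin m} {v : Vec (Fin m) k} {b : Fin k} →
                    AscentAbove x (y ∷ v) (suc b) ⇔ AscentAbove x v b
  ascentAbove-suc = mk⇔
    (λ { (suc b⁺ , eq , rest) → b⁺ , suc-injective eq , rest })
    (λ (b⁺ , eq , rest) → suc b⁺ , cong suc eq , rest)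

  count-ascentAbove : (x : Fin m) (v : Vec (Fin m) k) →
                      count (ascentAbove? x v) ≡ ascentsAbove (toℕ x) (word v)
  count-ascentAbove x []      = refl
  count-ascentAbove {m} x (y ∷ v) = trans (count-suc (ascentAbove? x (y ∷ v))) (cong₂ _+_ (first v)
    (trans (length-filter-cong _ (ascentAbove? x v)
             (λ b → does-⇔ ascentAbove-suc (ascentAbove? x (y ∷ v) (suc b)) (ascentAbove? x v b))
             (allFin _))
           (count-ascentAbove x v)))
    where
    first : ∀ {k} (v : Vec (Fin m) k) →
            indicator (does (ascentAbove? x (y ∷ v) zero)) ≡ ascentAt (toℕ x) (toℕ y) (word v)
    first []      = cong indicator (dec-false (ascentAbove? x (y ∷ []) zero) λ { (zero , () , _) })
    first (z ∷ v) = cong indicator (does-⇔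
      (mk⇔ (λ { (zero , () , _) ; (suc zero , _ , x<y , y<z) → x<y , y<z ; (suc (suc _) , () , _) })
           (λ (x<y , y<z) → suc zero , refl , x<y , y<z))
      (ascentAbove? x (y ∷ z ∷ v) zero) (toℕ x <? toℕ y ×-dec toℕ y <? toℕ z))

  OccurrenceIn : Vec (Fin m) k → Fin k × Fin k → Set
  OccurrenceIn v (a , b) = a Fin.< b × AscentAbove (lookup v a) v b

  occurrenceIn? : (v : Vec (Fin m) k) → Decidable (OccurrenceIn v)
  occurrenceIn? v (a , b) = a Fin.<? b ×-dec ascentAbove? (lookup v a) v b

  sum-occurrenceIn : (v : Vec (Fin m) k) →
    ListAction.sum (map (λ a → count (λ b → occurrenceIn? v (a , b))) (allFin k)) ≡ occ (word v)
  sum-occurrenceIn []      = refl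
  sum-occurrenceIn {k = suc k} (x ∷ v) = begin
    ListAction.sum (map h (allFin (suc k)))
      ≡⟨ cong (ListAction.sum ∘ map h) (allFin-suc k) ⟩
    h zero + ListAction.sum (map h (map suc (allFin k)))
      ≡⟨ cong (λ xs → h zero + ListAction.sum xs) (map-∘ (allFin k)) ⟨
    h zero + ListAction.sum (map (h ∘ suc) (allFin k))
      ≡⟨ cong₂ (λ s xs → s + ListAction.sum xs) h-zero (map-cong h-suc (allFin k)) ⟩
    ascentsAbove (toℕ x) (word v) +
      ListAction.sum (map (λ a → count (λ b → occurrenceIn? v (a , b))) (allFin k))
      ≡⟨ cong (ascentsAbove (toℕ x) (word v) +_) (sum-occurrenceIn v) ⟩
    occ (word (x ∷ v)) ∎
    where
    open ≡-Reasoning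
    h : Fin (suc k) → ℕ
    h a = count (λ b → occurrenceIn? (x ∷ v) (a , b))
    h-zero : h zero ≡ ascentsAbove (toℕ x) (word v)
    h-zero = trans (count-suc (λ b → occurrenceIn? (x ∷ v) (zero , b))) (cong₂ _+_
      (cong indicator (dec-false (occurrenceIn? (x ∷ v) (zero , zero)) λ { (() , _) }))
      (trans (length-filter-cong _ (ascentAbove? x v) (λ b → does-⇔
         (mk⇔ (λ (_ , p) → Equivalence.to ascentAbove-suc p)
              (λ p → z<s , Equivalence.from ascentAbove-suc p))
         (occurrenceIn? (x ∷ v) (zero , suc b)) (ascentAbove? x v b)) (allFin k))
       (count-ascentAbove x v)))
    h-suc : ∀ a → h (suc a) ≡ count (λ b → occurrenceIn? v (a , b))
    h-suc a = trans (count-suc (λ b → occurrenceIn? (x ∷ v) (suc a , b))) (cong₂ _+_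
      (cong indicator (dec-false (occurrenceIn? (x ∷ v) (suc a , zero)) λ { (() , _) }))
      (length-filter-cong _ (λ b → occurrenceIn? v (a , b)) (λ b → does-⇔
         (mk⇔ (λ (a<b , p) → s<s⁻¹ a<b , Equivalence.to ascentAbove-suc p)
              (λ (a<b , p) → s<s a<b , Equivalence.from ascentAbove-suc p))
         (occurrenceIn? (x ∷ v) (suc a , suc b)) (occurrenceIn? v (a , b))) (allFin k)))

  occurrences1-23-word : (π : Vec (Fin n) n) → occurrences1-23 π ≡ occ (word π)
  occurrences1-23-word {n} π = trans
    (length-filter-cartesianProduct (occurrence1-23? π) (allFin n) (allFin n))
    (sum-occurrenceIn π)

-- Generating functions

-- The raw semiring is a parameter of its own so that the statements unfold to those of
-- Defs when it is instantiated with ℤ[y].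
module GeneratingFunctions {c ℓ : Level} (raw : RawSemiring c ℓ)
  (isCommutativeSemiring : IsCommutativeSemiring
    (RawSemiring._≈_ raw) (RawSemiring._+_ raw) (RawSemiring._*_ raw)
    (RawSemiring.0# raw) (RawSemiring.1# raw)) where
  private
    R-commutativeSemiring : CommutativeSemiring c ℓ
    R-commutativeSemiring = record { isCommutativeSemiring = isCommutativeSemiring }
    module R = CommutativeSemiring R-commutativeSemiring
    open Exp R-commutativeSemiring using (^-congʳ; ^-homo-*)
    open Defs.PowerSeries raw
    open PowerSeriesProperties R-commutativeSemiring
    open RawSemiring rawSemiring using (_≈_; _+_; _*_; 1#)
    module Q = CommutativeSemiring commutativeSemiring
    open SemiringOps raw using () renaming (_^_ to _^ᴿ_; sum to sumᴿ)
    open SemiringOps rawSemiring using (_^_; sum; product)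
    open MonoidSum R.+-monoid using (sum-cong-≋)
    open Words
  open Weights R-commutativeSemiring {List ℕ} public

  -- The functional equations of F and G

  module _ (q : R.Carrier) (F : Series)
    (F-weight : ∀ n → F n R.≈ weight (λ w → q ^ᴿ occ w) (avoiders n)) where

    G : Series
    G n = weight (λ w → q ^ᴿ occ⁺ w) (avoiders n)

    private
      open ≈-Reasoning R.setoid

      -- Serves both equations. The length argument of `h` is there for `G`, where `α` contributes
      -- an extra power of `q` equal to its length.
      weight-avoiders-suc : (f : List ℕ → R.Carrier) (h : ℕ → List ℕ → R.Carrier) →
        (∀ {n β α} → AvoidingPermutation n α → f (glue β α) R.≈ q ^ᴿ occ β R.* h n α) →
        ∀ n → weight f (avoiders (suc n)) R.≈ (F * λ m → weight (h m) (avoiders m)) n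
      weight-avoiders-suc f h f-glue n = begin
        weight f (avoiders (suc n))
          ≈⟨ weight-↭ f (avoiders-suc n) ⟩
        weight f (concat (tabulate block))
          ≈⟨ weight-concat-tabulate f block ⟩
        sumᴿ (λ i → weight f (block i))
          ≈⟨ sum-cong-≋ {suc n} {λ i → weight f (block i)}
                {λ i → F (toℕ i) R.* weight (h (n ∸ toℕ i)) (avoiders (n ∸ toℕ i))} (λ i → R.trans
                (weight-cartesianProductWith f (λ w → q ^ᴿ occ w) (h (n ∸ toℕ i)) glue
                  (avoiders (toℕ i))
                  (All.tabulate λ α∈ β → f-glue (∈-avoiders⁻ α∈)))
                (R.*-congʳ (R.sym (F-weight (toℕ i))))) ⟩
        (F * λ m → weight (h m) (avoiders m)) n ∎
        where
        block : Fin (suc n) → List (List ℕ)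
        block i = cartesianProductWith glue (avoiders (toℕ i)) (avoiders (n ∸ toℕ i))

      X*-*-suc : ∀ s t n → (X * s * t) (suc n) R.≈ (s * t) n
      X*-*-suc s t n = R.trans (Q.*-assoc X s t (suc n)) (X*-suc (s * t) n)

      X*-*-zero : ∀ s t → (X * s * t) 0 R.≈ R.0#
      X*-*-zero s t = R.trans (Q.*-assoc X s t 0) (X*-zero (s * t))

      -- The right side is left unsimplified because the weight of `avoiders 0`, whose one entry is
      -- the empty word, computes to exactly this.
      constantTerm : ∀ s t → (1# + X * s * t) 0 R.≈ R.1# R.+ R.0#
      constantTerm s t = R.+-congˡ (X*-*-zero s t)

    F-eq : F ≈ 1# + X * F * G
    F-eq zero    = R.trans (F-weight 0) (R.sym (constantTerm F G))
    F-eq (suc n) = begin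
      F (suc n)
        ≈⟨ F-weight (suc n) ⟩
      weight _ (avoiders (suc n))
        ≈⟨ weight-avoiders-suc (λ w → q ^ᴿ occ w) (λ _ w → q ^ᴿ occ⁺ w) (λ {n} {β} {α} p →
             R.trans (R.reflexive (≡.cong (q ^ᴿ_) (lemma β α p)))
               (^-homo-* q (occ β) (occ⁺ α))) n ⟩
      (F * G) n
        ≈⟨ X*-*-suc F G n ⟨
      (X * F * G) (suc n)
        ≈⟨ R.+-identityˡ _ ⟨
      (1# + X * F * G) (suc n) ∎
      where
      lemma : ∀ {n} β α → AvoidingPermutation n α → occ (glue β α) ≡ occ β ℕ.+ occ⁺ α
      lemma β α (≡.refl , α<n , _) = occ-glue β α α<n

    G-eq : G ≈ 1# + X * F * (G [ q ·X])
    G-eq zero    = R.sym (constantTerm F (G [ q ·X]))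
    G-eq (suc n) = begin
      weight _ (avoiders (suc n))
        ≈⟨ weight-avoiders-suc (λ w → q ^ᴿ occ⁺ w) (λ m w → q ^ᴿ m R.* q ^ᴿ occ⁺ w)
             (λ {n} {β} {α} p → R.trans (R.reflexive (≡.cong (q ^ᴿ_) (lemma β α p)))
               (R.trans (^-homo-* q (occ β) (n ℕ.+ occ⁺ α))
                 (R.*-congˡ (^-homo-* q n (occ⁺ α))))) n ⟩
      (F * λ m → weight (λ w → q ^ᴿ m R.* q ^ᴿ occ⁺ w) (avoiders m)) n
        ≈⟨ *-cong {F} {F} {λ m → weight (λ w → q ^ᴿ m R.* q ^ᴿ occ⁺ w) (avoiders m)} {G [ q ·X]}
              (λ _ → R.refl) (λ m → weight-*ˡ (λ w → q ^ᴿ occ⁺ w) (q ^ᴿ m) (avoiders m)) n ⟩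
      (F * (G [ q ·X])) n
        ≈⟨ X*-*-suc F (G [ q ·X]) n ⟨
      (X * F * (G [ q ·X])) (suc n)
        ≈⟨ R.+-identityˡ _ ⟨
      (1# + X * F * (G [ q ·X])) (suc n) ∎
      where
      lemma : ∀ {n} β α → AvoidingPermutation n α → occ⁺ (glue β α) ≡ occ β ℕ.+ (n ℕ.+ occ⁺ α)
      lemma β α (≡.refl , α<n , _) = occ⁺-glue β α α<n

  -- Solving the functional equations

  module _ (q : R.Carrier) (F G : Series)
    (F-eq : F ≈ 1# + X * F * G)
    (G-eq : G ≈ 1# + X * F * (G [ q ·X]))
    where

    private
      f g b a : ℕ → Series
      f k = F [ q ^ᴿ k ·X]
      g k = G [ q ^ᴿ k ·X]
      b k = constant (q ^ᴿ k)
      a d = constant (q ^ᴿ (d C 2))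

      -- Pascal's rule for the exponents, with `d C 1` equal to `d`.
      a-suc : ∀ d → a (suc d) ≈ a d * b d
      a-suc d = Q.trans {a (suc d)} {constant (q ^ᴿ (d C 2) R.* q ^ᴿ d)} {a d * b d}
        (constant-cong (R.trans
          (^-congʳ q exponent) (^-homo-* q (d C 2) d)))
        (constant-homo-* _ _)
        where
        exponent : suc d C 2 ≡ d C 2 ℕ.+ d
        exponent = ≡.trans (≡.sym (nCk+nC[k+1]≡[n+1]C[k+1] d 1))
          (≡.trans (ℕ.+-comm (d C 1) (d C 2)) (≡.cong (d C 2 ℕ.+_) (nC1≡n d)))

      -- The equation of `G` after multiplying x by the d-th power of `q`: the explicit `X` yields
      -- `b d`, and the two successive substitutions in `G` compose to the next power.
      g-step : ∀ d → g d ≈ 1# + b d * X * f d * g (suc d)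
      g-step d = begin
        G [ p ·X]
          ≈⟨ [·X]-cong p {G} {1# + X * F * (G [ q ·X])} G-eq ⟩
        (1# + X * F * (G [ q ·X])) [ p ·X]
          ≈⟨ [·X]-+ p 1# (X * F * (G [ q ·X])) ⟩
        (1# [ p ·X]) + ((X * F * (G [ q ·X])) [ p ·X])
          ≈⟨ Q.+-cong {1# [ p ·X]} {1#} {(X * F * (G [ q ·X])) [ p ·X]}
               ([·X]-1 p) ([·X]-* p (X * F) (G [ q ·X])) ⟩
        1# + ((X * F) [ p ·X]) * ((G [ q ·X]) [ p ·X])
          ≈⟨ Q.+-congˡ {1#}
               (*-cong {(X * F) [ p ·X]} {b d * X * f d} {(G [ q ·X]) [ p ·X]} {g (suc d)} XF GG) ⟩
        1# + b d * X * f d * g (suc d) ∎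
        where
        p = q ^ᴿ d
        open ≈-Reasoning Q.setoid
        XF : ((X * F) [ p ·X]) ≈ b d * X * f d
        XF = Q.trans {(X * F) [ p ·X]} {(X [ p ·X]) * f d} ([·X]-* p X F)
              (*-cong {X [ p ·X]} {b d * X} {f d} {f d} (X-[·X] p) (λ _ → R.refl))
        GG : ((G [ q ·X]) [ p ·X]) ≈ g (suc d)
        GG = Q.trans {(G [ q ·X]) [ p ·X]} {G [ p R.* q ·X]}
               ([·X]-[·X] q p G) ([·X]-cong₂ (R.*-comm p q) G)

      module I = Iteration commutativeSemiring

    summand : ℕ → Series
    summand d = X ^ suc d * constant (q ^ᴿ (d C 2)) * F
           * product {n = d} (λ j → F [ q ^ᴿ toℕ j ·X])

    private
      a₀ : a 0 ≈ 1#
      a₀ _ = R.refl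

      expansion : ∀ N → X * F * g 0 ≈ sum {n = N} (λ k → summand (toℕ k)) + summand N * g N
      expansion = I.iterate X F a b f g a₀ a-suc g-step

      summand₀ : summand 0 ≈ X * F
      summand₀ = I.term₀ X F a b f g a₀ a-suc g-step

      remainder : ∀ N n → n < suc N → (summand N * g N) n R.≈ R.0#
      remainder N n n<N = R.trans (lemma n) (X^*-zero (suc N) rest n<N)
        where
        p = product {n = N} (f ∘ toℕ)
        rest = (a N * F * p) * g N
        open CommutativeMonoidSolver Q.*-commutativeMonoid
        lemma : summand N * g N ≈ X ^ suc N * rest
        lemma = solve 5 (λ x a f p g → (((x ⊕ a) ⊕ f) ⊕ p) ⊕ g ⊜ x ⊕ (((a ⊕ f) ⊕ p) ⊕ g))
          (λ _ → R.refl) (X ^ suc N) (a N) F p (g N)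

    solution : F ≈ 1# + X * F + (λ n → sumᴿ {n = suc n} λ k → summand (suc (toℕ k)) n)
    solution n = begin
      F n
        ≈⟨ F-eq n ⟩
      1# n R.+ (X * F * G) n
        -- `g 0` substitutes 1 · x for x, which leaves each coefficient of `G` unchanged only up to
        -- the equality of the semiring.
        ≈⟨ R.+-congˡ (*-cong {X * F} {X * F} {G} {g 0} (λ _ → R.refl) (λ m → R.sym ([1·X] G m)) n) ⟩
      1# n R.+ (X * F * g 0) n
        ≈⟨ R.+-congˡ (expansion N n) ⟩
      1# n R.+ (sum {n = N} (λ k → summand (toℕ k)) n R.+ (summand N * g N) n)
        ≈⟨ R.+-congˡ (R.+-cong
             (sum-coefficient {N} (λ k → summand (toℕ k)) n)
             (remainder N n (ℕ.m<n⇒m<1+n (ℕ.m<n⇒m<1+n (ℕ.n<1+n n))))) ⟩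
      1# n R.+ (summand 0 n R.+ ∑ R.+ R.0#)
        ≈⟨ R.+-congˡ (R.+-identityʳ _) ⟩
      1# n R.+ (summand 0 n R.+ ∑)
        ≈⟨ R.+-congˡ (R.+-congʳ (summand₀ n)) ⟩
      1# n R.+ ((X * F) n R.+ ∑)
        ≈⟨ R.+-assoc _ _ _ ⟨
      1# n R.+ (X * F) n R.+ ∑ ∎
      where
      -- The sum over d < n + 2 unfolds into d = 0, which gives `X * F`, and d = 1, ..., n + 1,
      -- which are exactly the n + 1 terms kept by `∑∞` at the n-th coefficient.
      N = 2 ℕ.+ n
      ∑ = sumᴿ {n = suc n} λ k → summand (suc (toℕ k)) n
      open ≈-Reasoning R.setoid

open import Defs

-- Coefficients in ℤ[y]

-- Equality in `ℤ[y]` compares coefficients, and these are added and multiplied as in power series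
-- over ℤ, so every law is inherited from there.
ℤ[y]-commutativeSemiring : CommutativeSemiring _ _
ℤ[y]-commutativeSemiring = record
  { RawSemiring ℤ[y]-rawSemiring
  ; isCommutativeSemiring = isCommutativeSemiringˡ record
    { +-isCommutativeMonoid = record
      { isMonoid = record
        { isSemigroup = record
          { isMagma = record
            { isEquivalence = ≈-isEquivalence
            ; ∙-cong = λ {p} {p′} {q} {q′} →
                Z.+-cong {coeff p} {coeff p′} {coeff q} {coeff q′}
            }
          ; assoc = λ p q r → Z.+-assoc (coeff p) (coeff q) (coeff r)
          }
        ; identity = (λ p → Z.+-identityˡ (coeff p)) , (λ p → Z.+-identityʳ (coeff p))
        }
      ; comm = λ p q → Z.+-comm (coeff p) (coeff q)
      }
    ; *-isCommutativeMonoid = record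
      { isMonoid = record
        { isSemigroup = record
          { isMagma = record
            { isEquivalence = ≈-isEquivalence
            ; ∙-cong = λ {p} {p′} {q} {q′} →
                Z.*-cong {coeff p} {coeff p′} {coeff q} {coeff q′}
            }
          ; assoc = λ p q r → Z.*-assoc (coeff p) (coeff q) (coeff r)
          }
        ; identity = (λ p → Z.*-identityˡ (coeff p)) , (λ p → Z.*-identityʳ (coeff p))
        }
      ; comm = λ p q → Z.*-comm (coeff p) (coeff q)
      }
    ; distribʳ = λ p q r → Z.distribʳ (coeff p) (coeff q) (coeff r)
    ; zeroˡ = λ p → Z.zeroˡ (coeff p)
    }
  }
  where
  module Z = CommutativeSemiring
    (PowerSeriesProperties.commutativeSemiring ℤ.+-*-commutativeSemiring)
  ≈-isEquivalence : IsEquivalence (RawSemiring._≈_ ℤ[y]-rawSemiring)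
  ≈-isEquivalence = record
    { refl  = λ {p} → Z.refl {coeff p}
    ; sym   = λ {p} {q} → Z.sym {coeff p} {coeff q}
    ; trans = λ {p} {q} {r} → Z.trans {coeff p} {coeff q} {coeff r}
    }

open Words
open Weights ℤ[y]-commutativeSemiring using (weight)

-- In this form the coefficient is what a permutation with `k` occurrences contributes to the
-- filtered count for `r`, as given by `length-filter-∷`.
coeff-y^ : ∀ k r → coeff (y ^ʸ k) r ≡ ℤ.+ indicator (does (k ℕ.≟ r))
coeff-y^ zero    zero    = ≡.refl
coeff-y^ zero    (suc r) = ≡.refl
coeff-y^ (suc k) zero    = PowerSeriesProperties.X*-zero ℤ.+-*-commutativeSemiring (coeff (y ^ʸ k))
coeff-y^ (suc k) (suc r) =
  ≡.trans (PowerSeriesProperties.X*-suc ℤ.+-*-commutativeSemiring (coeff (y ^ʸ k)) r) (coeff-y^ k r)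

coeff-weight : ∀ {n} r (πs : List (Vec (Fin n) n)) →
               ℤ.+ length (filter (λ π → occurrences1-23 π ℕ.≟ r) πs) ≡
               coeff (weight (λ w → y ^ʸ occ w) (map word πs)) r
coeff-weight r []       = ≡.refl
coeff-weight r (π ∷ πs) = ≡.trans
  (≡.cong ℤ.+_ (length-filter-∷ (λ π → occurrences1-23 π ℕ.≟ r) π πs))
  (≡.cong₂ ℤ._+_
    (≡.trans (≡.cong (λ k → ℤ.+ indicator (does (k ℕ.≟ r))) (occurrences1-23-word π))
             (≡.sym (coeff-y^ (occ (word π)) r)))
    (coeff-weight r πs))

F1-23-weight : ∀ n r → coeff (F1-23 n) r ≡ coeff (weight (λ w → y ^ʸ occ w) (avoiders n)) r
F1-23-weight n r = ≡.trans
  (≡.cong ℤ.+_ (length-filter-× (λ π → ¬? (occurs132? π)) (λ π → occurrences1-23 π ℕ.≟ r) (S n)))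
  (coeff-weight r (filter (λ π → ¬? (occurs132? π)) (S n)))

theorem4p3 : F1-23 ≈ 1# + X * F1-23 + ∑∞ (λ k → summand (suc k)) summand-locallyFinite
theorem4p3 = solution y F1-23 (G y F1-23 F1-23-weight)
    (F-eq y F1-23 F1-23-weight) (G-eq y F1-23 F1-23-weight)
  where
  open GeneratingFunctions ℤ[y]-rawSemiring
    (CommutativeSemiring.isCommutativeSemiring ℤ[y]-commutativeSemiring)
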